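{- Let $G=(V,E)$ be a finite connected graph (loops allowed) equipped with a random walk $m=\{m_v\}_{v\in V}$ which is ergodic, with invariant distribution $\nu$, and suppose $G$ (with $m$) has Ricci curvature at least $\kappa>0$. Then for every $1$-Lipschitz function $f\colon V\to\mathbb{R}$ and every $t\ge 1$, \[\nu\big(f-E_\nu[f]>t\big)\le \exp\Big(-\frac{t^2\kappa}{7}\Big)\quad\text{and}\quad \nu\big(f-E_\nu[f]<-t\big)\le \exp\Big(-\frac{t^2\kappa}{7}\Big).\]
   Context: For a vertex $v$, $\Gamma(v)$ is the set of neighbors of $v$ and $N(v)=\Gamma(v)\cup\{v\}$. A random walk on $G$ is a family $m=\{m_v\}_{v\in V}$ of probability distributions on $V$ with $m_v$ supported on $N(v)$. It is ergodic if it has a unique invariant distribution $\nu$ (i.e. $\sum_{x}\nu(x)m_x(y)=\nu(y)$ for all $y$) and the distributions of the walk converge to $\nu$ from any starting vertex. $d(x,y)$ is the graph distance. For probability distributions $m_1,m_2$ on $V$, the transportation distance is $W(m_1,m_2)=\inf_A\sum_{x,y}A(x,y)d(x,y)$, the infimum over couplings $A\colon V\times V\to[0,1]$ with $\sum_y A(x,y)=m_1(x)$, $\sum_x A(x,y)=m_2(y)$. The (Ollivier) Ricci curvature is $\kappa(x,y)=1-W(m_x,m_y)/d(x,y)$ for $x\ne y$; $G$ has Ricci curvature at least $\kappa_0$ if $\kappa(x,y)\ge\kappa_0$ for all distinct $x,y\in V$. A function $f\colon V\to\mathbb{R}$ is $c$-Lipschitz if $|f(u)-f(v)|\le c$ for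 every edge $uv\in E$. $E_\nu$ denotes expectation with respect to $\nu$, and $\nu(\cdot)$ the $\nu$-probability of an event on $V$. -}

module Defs where

open import Data.Bool using (if_then_else_)
open import Data.Fin using (Fin)
import Data.Fin.Properties as Fin
open import Data.Fin.Subset using (Subset; _∈_)
open import Data.Fin.Subset.Properties using (_∈?_)
import Data.Integer as ℤ
import Data.Integer.Properties as ℤ
open import Data.Nat using (ℕ; zero; suc; NonZero)
import Data.Nat as ℕ
import Data.Nat.Properties as ℕ
open import Data.Product using (∃; ∃-syntax; _×_; _,_; proj₁; proj₂)
open import Data.Rational using (ℚ; 0ℚ; 1ℚ; ½)
import Data.Rational as Rat
import Data.Rational.Properties as Rat
open import Data.Rational.Unnormalised using (mkℚᵘ)
import Data.Rational.Unnormalised as ℚᵘ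
import Data.Rational.Unnormalised.Properties as ℚᵘ
open import Data.Rational.Solver using (module +-*-Solver)
open import Data.Sum using (_⊎_; inj₁; inj₂)
import Data.Vec.Functional as Vector
open import Level using (0ℓ)
open import Relation.Binary using (Rel; Decidable; Symmetric)
open import Relation.Binary.PropositionalEquality
open import Relation.Nullary using (¬_; Dec; yes; no; does; contradiction)
open import Relation.Nullary.Decidable using (map′; _×-dec_)
open import Relation.Unary using (Pred)

module Estimates where
  open import Data.Rational using (_+_; _*_; _-_; -_; ∣_∣; _≤_; _<_; _/_; *≤*; *<*)
  open Rat.≤-Reasoning
  open +-*-Solver using (solve; _:=_; _:+_; _:*_; _:-_; :-_; con)

  Eventually : Pred ℕ 0ℓ → Set
  Eventually P = ∃[ N ] ∀ n → N ℕ.≤ n → P n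

  Cauchy : (ℕ → ℚ) → Set
  Cauchy s = ∀ ε → 0ℚ < ε →
    ∃[ N ] ∀ m n → N ℕ.≤ m → N ℕ.≤ n → ∣ s m - s n ∣ ≤ ε

  ⊔ˡ : ∀ m n {k} → m ℕ.⊔ n ℕ.≤ k → m ℕ.≤ k
  ⊔ˡ m n = ℕ.m⊔n≤o⇒m≤o m n

  ⊔ʳ : ∀ m n {k} → m ℕ.⊔ n ℕ.≤ k → n ℕ.≤ k
  ⊔ʳ m n = ℕ.m⊔n≤o⇒n≤o m n

  0<½ : 0ℚ < ½
  0<½ = Rat.positive⁻¹ ½

  0<1 : 0ℚ < 1ℚ
  0<1 = Rat.positive⁻¹ 1ℚ

  0<* : ∀ {p q} → 0ℚ < p → 0ℚ < q → 0ℚ < p * q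
  0<* {p} {q} 0<p 0<q = begin-strict
    0ℚ      ≡⟨ Rat.*-zeroˡ q ⟨
    0ℚ * q  <⟨ Rat.*-monoˡ-<-pos q ⦃ Rat.positive 0<q ⦄ 0<p ⟩
    p * q   ∎

  0≤* : ∀ {p q} → 0ℚ ≤ p → 0ℚ ≤ q → 0ℚ ≤ p * q
  0≤* {p} {q} 0≤p 0≤q = begin
    0ℚ      ≡⟨ Rat.*-zeroˡ q ⟨
    0ℚ * q  ≤⟨ Rat.*-monoʳ-≤-nonNeg q ⦃ Rat.nonNegative 0≤q ⦄ 0≤p ⟩
    p * q   ∎

  *-mono-≤ : ∀ {p q r s} → 0ℚ ≤ r → 0ℚ ≤ q → p ≤ q → r ≤ s → p * r ≤ q * s
  *-mono-≤ {p} {q} {r} {s} 0≤r 0≤q p≤q r≤s = Rat.≤-trans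
    (Rat.*-monoʳ-≤-nonNeg r ⦃ Rat.nonNegative 0≤r ⦄ p≤q)
    (Rat.*-monoˡ-≤-nonNeg q ⦃ Rat.nonNegative 0≤q ⦄ r≤s)

  halves : ∀ ε → ε * ½ + ε * ½ ≡ ε
  halves ε = trans (sym (Rat.*-distribˡ-+ ε ½ ½)) (Rat.*-identityʳ ε)

  half : ∀ {ε} → 0ℚ < ε → 0ℚ < ε * ½
  half 0<ε = 0<* 0<ε 0<½

  1/pos : ∀ {q} → 0ℚ < q → ∃[ r ] 0ℚ < r × r * q ≡ 1ℚ
  1/pos {q} 0<q = r , Rat.positive⁻¹ r ⦃ Rat.1/pos⇒pos q ⦄ , Rat.*-inverseˡ q
    where
    instance
      q>0 = Rat.positive 0<q
      q≢0 = Rat.pos⇒nonZero q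
    r = Rat.1/ q

  ∣∣-swap : ∀ p q → ∣ p - q ∣ ≡ ∣ q - p ∣
  ∣∣-swap p q = trans
    (cong ∣_∣ (solve 2 (λ p q → p :- q := :- (q :- p)) refl p q))
    (Rat.∣-p∣≡∣p∣ (q - p))

  ∣∣-triangle : ∀ p q r → ∣ p - r ∣ ≤ ∣ p - q ∣ + ∣ q - r ∣
  ∣∣-triangle p q r = begin
    ∣ p - r ∣
      ≡⟨ cong ∣_∣ (solve 3 (λ p q r → p :- r := (p :- q) :+ (q :- r)) refl p q r) ⟩
    ∣ (p - q) + (q - r) ∣  ≤⟨ Rat.∣p+q∣≤∣p∣+∣q∣ (p - q) (q - r) ⟩
    ∣ p - q ∣ + ∣ q - r ∣  ∎

  ∣∣-reverse : ∀ p q → ∣ p ∣ - ∣ q ∣ ≤ ∣ p - q ∣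
  ∣∣-reverse p q = begin
    ∣ p ∣ - ∣ q ∣
      ≡⟨ cong (λ x → ∣ x ∣ - ∣ q ∣)
           (solve 2 (λ p q → p := (p :- q) :+ q) refl p q) ⟩
    ∣ (p - q) + q ∣ - ∣ q ∣
      ≤⟨ Rat.+-monoˡ-≤ (- ∣ q ∣) (Rat.∣p+q∣≤∣p∣+∣q∣ (p - q) q) ⟩
    ∣ p - q ∣ + ∣ q ∣ - ∣ q ∣
      ≡⟨ solve 2 (λ a b → a :+ b :- b := a) refl ∣ p - q ∣ ∣ q ∣ ⟩
    ∣ p - q ∣ ∎

  ∣∣p∣-∣q∣∣≤∣p-q∣ : ∀ p q → ∣ ∣ p ∣ - ∣ q ∣ ∣ ≤ ∣ p - q ∣
  ∣∣p∣-∣q∣∣≤∣p-q∣ p q with Rat.∣p∣≡p∨∣p∣≡-p (∣ p ∣ - ∣ q ∣)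
  ... | inj₁ eq = subst (_≤ ∣ p - q ∣) (sym eq) (∣∣-reverse p q)
  ... | inj₂ eq = begin
    ∣ ∣ p ∣ - ∣ q ∣ ∣  ≡⟨ eq ⟩
    - (∣ p ∣ - ∣ q ∣)
      ≡⟨ solve 2 (λ a b → :- (a :- b) := b :- a) refl ∣ p ∣ ∣ q ∣ ⟩
    ∣ q ∣ - ∣ p ∣    ≤⟨ ∣∣-reverse q p ⟩
    ∣ q - p ∣        ≡⟨ ∣∣-swap q p ⟩
    ∣ p - q ∣ ∎

  Cauchy⇒bounded : ∀ {s} → Cauchy s →
    ∃[ B ] 0ℚ < B × Eventually (λ n → ∣ s n ∣ ≤ B)
  Cauchy⇒bounded {s} cauchy with N , close ← cauchy 1ℚ 0<1 =
    1ℚ + ∣ s N ∣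
    , Rat.+-mono-<-≤ 0<1 (Rat.0≤∣p∣ (s N))
    , N , λ n N≤n → begin
      ∣ s n ∣
        ≡⟨ cong ∣_∣ (solve 2 (λ a b → a := (a :- b) :+ b) refl (s n) (s N)) ⟩
      ∣ (s n - s N) + s N ∣      ≤⟨ Rat.∣p+q∣≤∣p∣+∣q∣ (s n - s N) (s N) ⟩
      ∣ s n - s N ∣ + ∣ s N ∣    ≤⟨ Rat.+-monoˡ-≤ ∣ s N ∣ (close n N N≤n ℕ.≤-refl) ⟩
      1ℚ + ∣ s N ∣              ∎

  fromℕ : ℕ → ℚ
  fromℕ n = ℤ.+ n / 1

  fromℕ-suc : ∀ n → fromℕ (suc n) ≡ fromℕ n + 1ℚ
  fromℕ-suc n = Rat.toℚᵘ-injective (ℚᵘ.≃-trans (Rat.toℚᵘ-fromℚᵘ (mkℚᵘ (ℤ.+ suc n) 0))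
    (ℚᵘ.≃-trans sucᵘ (ℚᵘ.≃-sym (ℚᵘ.≃-trans (Rat.toℚᵘ-homo-+ (fromℕ n) 1ℚ)
      (ℚᵘ.+-congˡ (Rat.toℚᵘ 1ℚ) (Rat.toℚᵘ-fromℚᵘ (mkℚᵘ (ℤ.+ n) 0)))))))
    where
    sucᵘ : mkℚᵘ (ℤ.+ suc n) 0 ℚᵘ.≃ mkℚᵘ (ℤ.+ n) 0 ℚᵘ.+ mkℚᵘ (ℤ.+ 1) 0
    sucᵘ = ℚᵘ.*≡* (cong (ℤ._* ℤ.+ 1) (sym (trans
      (cong (ℤ._+ ℤ.+ 1) (ℤ.*-identityʳ (ℤ.+ n)))
      (cong ℤ.+_ (ℕ.+-comm n 1)))))

  1/suc : ℕ → ℚ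
  1/suc k = ℤ.+ 1 / suc k

  1/suc-inverse : ∀ k → 1/suc k * fromℕ (suc k) ≡ 1ℚ
  1/suc-inverse k = Rat.toℚᵘ-injective (ℚᵘ.≃-trans
    (Rat.toℚᵘ-homo-* (1/suc k) (fromℕ (suc k)))
    (ℚᵘ.≃-trans (ℚᵘ.*-cong (Rat.toℚᵘ-fromℚᵘ (mkℚᵘ (ℤ.+ 1) k))
                           (Rat.toℚᵘ-fromℚᵘ (mkℚᵘ (ℤ.+ suc k) 0)))
      (ℚᵘ.*≡* (cong ℤ.+_ eq))))
    where
    eq : (1 ℕ.* suc k) ℕ.* 1 ≡ 1 ℕ.* (suc k ℕ.* 1)
    eq = ℕ.*-assoc 1 (suc k) 1

  0≤fromℕ : ∀ n → 0ℚ ≤ fromℕ n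
  0≤fromℕ zero    = Rat.≤-refl
  0≤fromℕ (suc n) = subst (0ℚ ≤_) (sym (fromℕ-suc n))
    (Rat.+-mono-≤ (0≤fromℕ n) (Rat.<⇒≤ 0<1))

  0<fromℕ : ∀ n → 0ℚ < fromℕ (suc n)
  0<fromℕ n = subst (0ℚ <_) (sym (fromℕ-suc n)) (Rat.+-mono-≤-< (0≤fromℕ n) 0<1)

  fromℕ-mono : ∀ {m n} → m ℕ.≤ n → fromℕ m ≤ fromℕ n
  fromℕ-mono {n = n} ℕ.z≤n = 0≤fromℕ n
  fromℕ-mono {suc m} {suc n} (ℕ.s≤s m≤n) =
    subst₂ _≤_ (sym (fromℕ-suc m)) (sym (fromℕ-suc n))
      (Rat.+-monoˡ-≤ 1ℚ (fromℕ-mono m≤n))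

  0≤1/suc : ∀ k → 0ℚ ≤ 1/suc k
  0≤1/suc k = Rat.nonNegative⁻¹ (1/suc k) ⦃ Rat.normalize-nonNeg 1 (suc k) ⦄

  archimedean : ∀ q → ∃[ n ] q ≤ fromℕ n
  archimedean q@(Rat.mkℚ n d-1 _) = ℤ.∣ n ∣ , Rat.toℚᵘ-cancel-≤
    (ℚᵘ.≤-respʳ-≃ (ℚᵘ.≃-sym (Rat.toℚᵘ-fromℚᵘ (mkℚᵘ (ℤ.+ ℤ.∣ n ∣) 0)))
      (ℚᵘ.*≤* (bound n)))
    where
    bound : ∀ n → n ℤ.* ℤ.+ 1 ℤ.≤ ℤ.+ ℤ.∣ n ∣ ℤ.* ℤ.+ suc d-1
    bound (ℤ.+ n) = subst₂ ℤ._≤_ (ℤ.pos-* n 1) (ℤ.pos-* n (suc d-1))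
      (ℤ.+≤+ (ℕ.*-monoʳ-≤ n (ℕ.s≤s ℕ.z≤n)))
    bound ℤ.-[1+ n ] = ℤ.-≤+

  -- x ^ k / k !
  expTerm : ℚ → ℕ → ℚ
  expTerm x zero    = 1ℚ
  expTerm x (suc k) = expTerm x k * x * 1/suc k

  -- The sum of the first n terms
  expSum : ℚ → ℕ → ℚ
  expSum x zero    = 0ℚ
  expSum x (suc n) = expSum x n + expTerm x n

  0≤expTerm : ∀ {B} → 0ℚ ≤ B → ∀ k → 0ℚ ≤ expTerm B k
  0≤expTerm 0≤B zero    = Rat.<⇒≤ 0<1
  0≤expTerm 0≤B (suc k) = 0≤* (0≤* (0≤expTerm 0≤B k) 0≤B) (0≤1/suc k)

  expTerm-suc : ∀ x k → fromℕ (suc k) * expTerm x (suc k) ≡ expTerm x k * x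
  expTerm-suc x k = begin-equality
    fromℕ (suc k) * (expTerm x k * x * 1/suc k)
      ≡⟨ solve 3 (λ a b c → a :* (b :* c) := b :* (c :* a)) refl
           (fromℕ (suc k)) (expTerm x k * x) (1/suc k) ⟩
    expTerm x k * x * (1/suc k * fromℕ (suc k))
      ≡⟨ cong (expTerm x k * x *_) (1/suc-inverse k) ⟩
    expTerm x k * x * 1ℚ  ≡⟨ Rat.*-identityʳ _ ⟩
    expTerm x k * x ∎

  module _ {B : ℚ} (0≤B : 0ℚ ≤ B) where
    private
      T = expTerm B
      0≤T = 0≤expTerm 0≤B

    ∣expTerm∣ : ∀ {x} → ∣ x ∣ ≤ B → ∀ k → ∣ expTerm x k ∣ ≤ T k
    ∣expTerm∣ ∣x∣≤B zero = Rat.≤-refl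
    ∣expTerm∣ {x} ∣x∣≤B (suc k) = begin
      ∣ expTerm x k * x * 1/suc k ∣    ≡⟨ Rat.∣p*q∣≡∣p∣*∣q∣ (expTerm x k * x) (1/suc k) ⟩
      ∣ expTerm x k * x ∣ * ∣ 1/suc k ∣
        ≡⟨ cong₂ _*_ (Rat.∣p*q∣≡∣p∣*∣q∣ (expTerm x k) x) (Rat.0≤p⇒∣p∣≡p (0≤1/suc k)) ⟩
      ∣ expTerm x k ∣ * ∣ x ∣ * 1/suc k
        ≤⟨ Rat.*-monoʳ-≤-nonNeg (1/suc k) ⦃ Rat.nonNegative (0≤1/suc k) ⦄
             (*-mono-≤ (Rat.0≤∣p∣ x) (0≤T k) (∣expTerm∣ ∣x∣≤B k) ∣x∣≤B) ⟩
      T k * B * 1/suc k  ∎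

    ∣expTerm-∣ : ∀ {x y} → ∣ x ∣ ≤ B → ∣ y ∣ ≤ B → ∀ k →
      ∣ expTerm x (suc k) - expTerm y (suc k) ∣ ≤ ∣ x - y ∣ * T k
    ∣expTerm-∣ {x} {y} _ _ zero = Rat.≤-reflexive (trans
      (cong ∣_∣ (solve 2 (λ x y → con 1ℚ :* x :* con 1ℚ :- con 1ℚ :* y :* con 1ℚ := x :- y)
                  refl x y))
      (sym (Rat.*-identityʳ ∣ x - y ∣)))
    ∣expTerm-∣ {x} {y} ∣x∣≤B ∣y∣≤B (suc k) = begin
      ∣ a * x * r - b * y * r ∣
        ≡⟨ cong ∣_∣ (solve 5 (λ a b x y r →
             a :* x :* r :- b :* y :* r := ((a :- b) :* x :+ b :* (x :- y)) :* r)
             refl a b x y r) ⟩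
      ∣ ((a - b) * x + b * (x - y)) * r ∣
        ≡⟨ Rat.∣p*q∣≡∣p∣*∣q∣ ((a - b) * x + b * (x - y)) r ⟩
      ∣ (a - b) * x + b * (x - y) ∣ * ∣ r ∣
        ≡⟨ cong (∣ (a - b) * x + b * (x - y) ∣ *_) (Rat.0≤p⇒∣p∣≡p (0≤1/suc (suc k))) ⟩
      ∣ (a - b) * x + b * (x - y) ∣ * r
        ≤⟨ *r (Rat.∣p+q∣≤∣p∣+∣q∣ ((a - b) * x) (b * (x - y))) ⟩
      (∣ (a - b) * x ∣ + ∣ b * (x - y) ∣) * r
        ≡⟨ cong₂ (λ u v → (u + v) * r)
             (Rat.∣p*q∣≡∣p∣*∣q∣ (a - b) x) (Rat.∣p*q∣≡∣p∣*∣q∣ b (x - y)) ⟩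
      (∣ a - b ∣ * ∣ x ∣ + ∣ b ∣ * ∣ x - y ∣) * r
        ≤⟨ *r (Rat.+-mono-≤
             (*-mono-≤ (Rat.0≤∣p∣ x) (0≤* (Rat.0≤∣p∣ (x - y)) (0≤T k))
                       (∣expTerm-∣ ∣x∣≤B ∣y∣≤B k) ∣x∣≤B)
             (Rat.*-monoʳ-≤-nonNeg ∣ x - y ∣ ⦃ Rat.nonNegative (Rat.0≤∣p∣ (x - y)) ⦄
                       (∣expTerm∣ ∣y∣≤B (suc k)))) ⟩
      (d * T k * B + T (suc k) * d) * r
        ≡⟨ cong (λ u → (u + T (suc k) * d) * r)
             (trans (Rat.*-assoc d (T k) B) (cong (d *_) (sym (expTerm-suc B k)))) ⟩
      (d * (fromℕ (suc k) * T (suc k)) + T (suc k) * d) * r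
        ≡⟨ solve 4 (λ d n t r → (d :* (n :* t) :+ t :* d) :* r
                             := d :* t :* (r :* (n :+ con 1ℚ)))
             refl d (fromℕ (suc k)) (T (suc k)) r ⟩
      d * T (suc k) * (r * (fromℕ (suc k) + 1ℚ))
        ≡⟨ cong (λ u → d * T (suc k) * (r * u)) (sym (fromℕ-suc (suc k))) ⟩
      d * T (suc k) * (r * fromℕ (suc (suc k)))
        ≡⟨ cong (d * T (suc k) *_) (1/suc-inverse (suc k)) ⟩
      d * T (suc k) * 1ℚ  ≡⟨ Rat.*-identityʳ _ ⟩
      d * T (suc k) ∎
      where
      a = expTerm x (suc k)
      b = expTerm y (suc k)
      r = 1/suc (suc k)
      d = ∣ x - y ∣
      *r : ∀ {u v} → u ≤ v → u * r ≤ v * r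
      *r = Rat.*-monoʳ-≤-nonNeg r ⦃ Rat.nonNegative (0≤1/suc (suc k)) ⦄

    expSum-mono : ∀ m j → expSum B m ≤ expSum B (j ℕ.+ m)
    expSum-mono m zero    = Rat.≤-refl
    expSum-mono m (suc j) = begin
      expSum B m              ≤⟨ expSum-mono m j ⟩
      expSum B (j ℕ.+ m)       ≡⟨ Rat.+-identityʳ _ ⟨
      expSum B (j ℕ.+ m) + 0ℚ  ≤⟨ Rat.+-monoʳ-≤ (expSum B (j ℕ.+ m)) (0≤T (j ℕ.+ m)) ⟩
      expSum B (suc j ℕ.+ m)   ∎

    0≤expSum : ∀ n → 0ℚ ≤ expSum B n
    0≤expSum zero    = Rat.≤-refl
    0≤expSum (suc n) = Rat.+-mono-≤ (0≤expSum n) (0≤T n)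

    ∣expSum-args∣ : ∀ {x y} → ∣ x ∣ ≤ B → ∣ y ∣ ≤ B → ∀ n →
      ∣ expSum x n - expSum y n ∣ ≤ ∣ x - y ∣ * expSum B n
    ∣expSum-args∣ {x} {y} _ _ zero = Rat.≤-reflexive (sym (Rat.*-zeroʳ ∣ x - y ∣))
    ∣expSum-args∣ {x} {y} ∣x∣≤B ∣y∣≤B (suc n) =
      Rat.≤-trans (shifted n) (Rat.*-monoˡ-≤-nonNeg d ⦃ Rat.nonNegative (Rat.0≤∣p∣ (x - y)) ⦄
        (expSum-mono n 1))
      where
      d = ∣ x - y ∣
      shifted : ∀ n → ∣ expSum x (suc n) - expSum y (suc n) ∣ ≤ d * expSum B n
      shifted zero    = Rat.≤-reflexive (sym (Rat.*-zeroʳ d))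
      shifted (suc n) = begin
        ∣ (expSum x (suc n) + expTerm x (suc n)) - (expSum y (suc n) + expTerm y (suc n)) ∣
          ≡⟨ cong ∣_∣ (solve 4 (λ a b c e → (a :+ b) :- (c :+ e) := (a :- c) :+ (b :- e)) refl
               (expSum x (suc n)) (expTerm x (suc n)) (expSum y (suc n)) (expTerm y (suc n))) ⟩
        ∣ (expSum x (suc n) - expSum y (suc n)) + (expTerm x (suc n) - expTerm y (suc n)) ∣
          ≤⟨ Rat.∣p+q∣≤∣p∣+∣q∣ (expSum x (suc n) - expSum y (suc n)) _ ⟩
        ∣ expSum x (suc n) - expSum y (suc n) ∣ + ∣ expTerm x (suc n) - expTerm y (suc n) ∣
          ≤⟨ Rat.+-mono-≤ (shifted n) (∣expTerm-∣ ∣x∣≤B ∣y∣≤B n) ⟩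
        d * expSum B n + d * T n
          ≡⟨ Rat.*-distribˡ-+ d (expSum B n) (T n) ⟨
        d * expSum B (suc n) ∎

    ∣expSum-tail∣ : ∀ {x} → ∣ x ∣ ≤ B → ∀ n j →
      ∣ expSum x (j ℕ.+ n) - expSum x n ∣ ≤ expSum B (j ℕ.+ n) - expSum B n
    ∣expSum-tail∣ {x} _ n zero = Rat.≤-reflexive
      (trans (cong ∣_∣ (Rat.+-inverseʳ (expSum x n))) (sym (Rat.+-inverseʳ (expSum B n))))
    ∣expSum-tail∣ {x} ∣x∣≤B n (suc j) = begin
      ∣ (expSum x i + expTerm x i) - expSum x n ∣
        ≡⟨ cong ∣_∣ (solve 3 (λ a b c → (a :+ b) :- c := (a :- c) :+ b) refl
             (expSum x i) (expTerm x i) (expSum x n)) ⟩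
      ∣ (expSum x i - expSum x n) + expTerm x i ∣
        ≤⟨ Rat.∣p+q∣≤∣p∣+∣q∣ (expSum x i - expSum x n) (expTerm x i) ⟩
      ∣ expSum x i - expSum x n ∣ + ∣ expTerm x i ∣
        ≤⟨ Rat.+-mono-≤ (∣expSum-tail∣ ∣x∣≤B n j) (∣expTerm∣ ∣x∣≤B i) ⟩
      (expSum B i - expSum B n) + T i
        ≡⟨ solve 3 (λ a b c → (a :- c) :+ b := (a :+ b) :- c) refl
             (expSum B i) (T i) (expSum B n) ⟩
      (expSum B i + T i) - expSum B n ∎
      where i = j ℕ.+ n

    module Tail (K : ℕ) (B+B≤K : B + B ≤ fromℕ K) where

      T-halves : ∀ n → K ℕ.≤ n → T (suc n) + T (suc n) ≤ T n
      T-halves n K≤n = begin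
        T n * B * r + T n * B * r
          ≡⟨ solve 3 (λ t b r → t :* b :* r :+ t :* b :* r := t :* (b :+ b) :* r) refl (T n) B r ⟩
        T n * (B + B) * r
          ≤⟨ Rat.*-monoʳ-≤-nonNeg r ⦃ Rat.nonNegative (0≤1/suc n) ⦄
               (Rat.*-monoˡ-≤-nonNeg (T n) ⦃ Rat.nonNegative (0≤T n) ⦄
                 (Rat.≤-trans B+B≤K (fromℕ-mono (ℕ.m≤n⇒m≤1+n K≤n)))) ⟩
        T n * fromℕ (suc n) * r
          ≡⟨ solve 3 (λ t f r → t :* f :* r := t :* (r :* f)) refl (T n) (fromℕ (suc n)) r ⟩
        T n * (r * fromℕ (suc n))  ≡⟨ cong (T n *_) (1/suc-inverse n) ⟩
        T n * 1ℚ                  ≡⟨ Rat.*-identityʳ (T n) ⟩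
        T n ∎
        where r = 1/suc n

      expSum+2T : ∀ n j → K ℕ.≤ n →
        expSum B (j ℕ.+ n) + (T (j ℕ.+ n) + T (j ℕ.+ n)) ≤ expSum B n + (T n + T n)
      expSum+2T n zero    K≤n = Rat.≤-refl
      expSum+2T n (suc j) K≤n = begin
        (expSum B i + T i) + (T (suc i) + T (suc i))
          ≤⟨ Rat.+-monoʳ-≤ (expSum B i + T i) (T-halves i (ℕ.≤-trans K≤n (ℕ.m≤n+m n j))) ⟩
        (expSum B i + T i) + T i    ≡⟨ Rat.+-assoc (expSum B i) (T i) (T i) ⟩
        expSum B i + (T i + T i)    ≤⟨ expSum+2T n j K≤n ⟩
        expSum B n + (T n + T n) ∎
        where i = j ℕ.+ n

      expSum-tail : ∀ n j → K ℕ.≤ n → expSum B (j ℕ.+ n) - expSum B n ≤ T n + T n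
      expSum-tail n j K≤n = begin
        expSum B i - expSum B n
          ≡⟨ solve 2 (λ a b → a :- b := (a :+ con 0ℚ) :- b) refl (expSum B i) (expSum B n) ⟩
        (expSum B i + 0ℚ) - expSum B n
          ≤⟨ Rat.+-monoˡ-≤ (- expSum B n) (Rat.+-monoʳ-≤ (expSum B i)
               (Rat.+-mono-≤ (0≤T i) (0≤T i))) ⟩
        (expSum B i + (T i + T i)) - expSum B n
          ≤⟨ Rat.+-monoˡ-≤ (- expSum B n) (expSum+2T n j K≤n) ⟩
        (expSum B n + (T n + T n)) - expSum B n
          ≡⟨ solve 2 (λ a b → (a :+ b) :- a := b) refl (expSum B n) (T n + T n) ⟩
        T n + T n ∎
        where i = j ℕ.+ n

      T-decay : ∀ j → fromℕ (suc j) * T (j ℕ.+ K) ≤ T K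
      T-decay zero    = Rat.≤-reflexive (Rat.*-identityˡ (T K))
      T-decay (suc j) = begin
        fromℕ (suc (suc j)) * t
          ≡⟨ cong (_* t) (fromℕ-suc (suc j)) ⟩
        (f + 1ℚ) * t
          ≤⟨ Rat.*-monoʳ-≤-nonNeg t ⦃ Rat.nonNegative (0≤T (suc j ℕ.+ K)) ⦄
               (Rat.+-monoʳ-≤ f (fromℕ-mono {1} {suc j} (ℕ.s≤s ℕ.z≤n))) ⟩
        (f + f) * t
          ≡⟨ solve 2 (λ f t → (f :+ f) :* t := f :* (t :+ t)) refl f t ⟩
        f * (t + t)
          ≤⟨ Rat.*-monoˡ-≤-nonNeg f ⦃ Rat.nonNegative (0≤fromℕ (suc j)) ⦄
               (T-halves (j ℕ.+ K) (ℕ.m≤n+m K j)) ⟩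
        f * T (j ℕ.+ K)  ≤⟨ T-decay j ⟩
        T K ∎
        where
        f = fromℕ (suc j)
        t = T (suc j ℕ.+ K)

      T-small : ∀ ε → 0ℚ < ε → ∃[ n ] K ℕ.≤ n × T n ≤ ε
      T-small ε 0<ε
        with r , 0<r , r*ε≡1 ← 1/pos 0<ε
        with j , TK*r≤j ← archimedean (T K * r) =
        j ℕ.+ K , ℕ.m≤n+m K j
        , Rat.*-cancelˡ-≤-pos f ⦃ Rat.positive (0<fromℕ j) ⦄ (begin
          f * T (j ℕ.+ K)  ≤⟨ T-decay j ⟩
          T K             ≡⟨ Rat.*-identityʳ (T K) ⟨
          T K * 1ℚ        ≡⟨ cong (T K *_) r*ε≡1 ⟨
          T K * (r * ε)   ≡⟨ Rat.*-assoc (T K) r ε ⟨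
          T K * r * ε
            ≤⟨ Rat.*-monoʳ-≤-nonNeg ε ⦃ Rat.nonNegative (Rat.<⇒≤ 0<ε) ⦄
                 (Rat.≤-trans TK*r≤j (fromℕ-mono (ℕ.n≤1+n j))) ⟩
          f * ε ∎)
        where f = fromℕ (suc j)

  *-close : ∀ {ε B C r u} → 0ℚ < ε → 0ℚ < B → 0ℚ < u → r * B ≡ 1ℚ → u * C ≡ 1ℚ →
    ∀ a b c d → ∣ a ∣ ≤ B → ∣ d ∣ ≤ C →
    ∣ a - b ∣ ≤ ε * ½ * u → ∣ c - d ∣ ≤ ε * ½ * r → ∣ a * c - b * d ∣ ≤ ε
  *-close {ε} {B} {C} {r} {u} 0<ε 0<B 0<u rB≡1 uC≡1 a b c d ∣a∣≤B ∣d∣≤C a≈b c≈d = begin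
    ∣ a * c - b * d ∣
      ≡⟨ cong ∣_∣ (solve 4 (λ a b c d → a :* c :- b :* d := a :* (c :- d) :+ (a :- b) :* d)
           refl a b c d) ⟩
    ∣ a * (c - d) + (a - b) * d ∣
      ≤⟨ Rat.∣p+q∣≤∣p∣+∣q∣ (a * (c - d)) ((a - b) * d) ⟩
    ∣ a * (c - d) ∣ + ∣ (a - b) * d ∣
      ≡⟨ cong₂ _+_ (Rat.∣p*q∣≡∣p∣*∣q∣ a (c - d)) (Rat.∣p*q∣≡∣p∣*∣q∣ (a - b) d) ⟩
    ∣ a ∣ * ∣ c - d ∣ + ∣ a - b ∣ * ∣ d ∣
      ≤⟨ Rat.+-mono-≤
           (*-mono-≤ (Rat.0≤∣p∣ (c - d)) (Rat.<⇒≤ 0<B) ∣a∣≤B c≈d)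
           (*-mono-≤ (Rat.0≤∣p∣ d) (Rat.<⇒≤ (0<* (half 0<ε) 0<u)) a≈b ∣d∣≤C) ⟩
    B * (ε * ½ * r) + ε * ½ * u * C
      ≡⟨ solve 5 (λ B h r u C → B :* (h :* r) :+ h :* u :* C
                             := h :* (r :* B) :+ h :* (u :* C)) refl B (ε * ½) r u C ⟩
    ε * ½ * (r * B) + ε * ½ * (u * C)
      ≡⟨ cong₂ (λ x y → ε * ½ * x + ε * ½ * y) rB≡1 uC≡1 ⟩
    ε * ½ * 1ℚ + ε * ½ * 1ℚ
      ≡⟨ cong₂ _+_ (Rat.*-identityʳ (ε * ½)) (Rat.*-identityʳ (ε * ½)) ⟩
    ε * ½ + ε * ½  ≡⟨ halves ε ⟩
    ε ∎

  module _ {ε B r : ℚ} {K n₀ : ℕ} (0<ε : 0ℚ < ε) (0≤B : 0ℚ ≤ B) (0<r : 0ℚ < r)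
    (B+B≤K : B + B ≤ fromℕ K) (K≤n₀ : K ℕ.≤ n₀) (T≤ : expTerm B n₀ ≤ ε * ½ * ½ * ½)
    (rD≡1 : r * (expSum B n₀ + 1ℚ) ≡ 1ℚ) where
    private
      q = ε * ½ * ½
      D = expSum B n₀

      D≤D+1 : D ≤ D + 1ℚ
      D≤D+1 = Rat.≤-trans (Rat.≤-reflexive (sym (Rat.+-identityʳ D)))
        (Rat.+-monoʳ-≤ D (Rat.<⇒≤ 0<1))

      tail : ∀ {x m} → ∣ x ∣ ≤ B → n₀ ℕ.≤ m → ∣ expSum x m - expSum x n₀ ∣ ≤ q
      tail {x} {m} ∣x∣≤B n₀≤m = subst (λ k → ∣ expSum x k - expSum x n₀ ∣ ≤ q)
        (ℕ.m∸n+n≡m n₀≤m) (begin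
          ∣ expSum x (m ℕ.∸ n₀ ℕ.+ n₀) - expSum x n₀ ∣
            ≤⟨ ∣expSum-tail∣ 0≤B ∣x∣≤B n₀ (m ℕ.∸ n₀) ⟩
          expSum B (m ℕ.∸ n₀ ℕ.+ n₀) - expSum B n₀
            ≤⟨ Tail.expSum-tail 0≤B K B+B≤K n₀ (m ℕ.∸ n₀) K≤n₀ ⟩
          expTerm B n₀ + expTerm B n₀    ≤⟨ Rat.+-mono-≤ T≤ T≤ ⟩
          q * ½ + q * ½                  ≡⟨ halves q ⟩
          q ∎)

      middle : ∀ {x y} → ∣ x ∣ ≤ B → ∣ y ∣ ≤ B → ∣ x - y ∣ ≤ ε * ½ * r →
        ∣ expSum x n₀ - expSum y n₀ ∣ ≤ ε * ½
      middle {x} {y} ∣x∣≤B ∣y∣≤B x≈y = begin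
        ∣ expSum x n₀ - expSum y n₀ ∣   ≤⟨ ∣expSum-args∣ 0≤B ∣x∣≤B ∣y∣≤B n₀ ⟩
        ∣ x - y ∣ * D
          ≤⟨ *-mono-≤ (0≤expSum 0≤B n₀) (Rat.<⇒≤ (0<* (half 0<ε) 0<r)) x≈y D≤D+1 ⟩
        ε * ½ * r * (D + 1ℚ)       ≡⟨ Rat.*-assoc (ε * ½) r (D + 1ℚ) ⟩
        ε * ½ * (r * (D + 1ℚ))     ≡⟨ cong (ε * ½ *_) rD≡1 ⟩
        ε * ½ * 1ℚ                ≡⟨ Rat.*-identityʳ (ε * ½) ⟩
        ε * ½ ∎

    exp-close : ∀ {x y m n} → ∣ x ∣ ≤ B → ∣ y ∣ ≤ B → ∣ x - y ∣ ≤ ε * ½ * r →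
      n₀ ℕ.≤ m → n₀ ℕ.≤ n → ∣ expSum x m - expSum y n ∣ ≤ ε
    exp-close {x} {y} {m} {n} ∣x∣≤B ∣y∣≤B x≈y n₀≤m n₀≤n = begin
      ∣ expSum x m - expSum y n ∣
        ≤⟨ ∣∣-triangle (expSum x m) (expSum x n₀) (expSum y n) ⟩
      ∣ expSum x m - expSum x n₀ ∣ + ∣ expSum x n₀ - expSum y n ∣
        ≤⟨ Rat.+-mono-≤ (tail ∣x∣≤B n₀≤m)
             (∣∣-triangle (expSum x n₀) (expSum y n₀) (expSum y n)) ⟩
      q + (∣ expSum x n₀ - expSum y n₀ ∣ + ∣ expSum y n₀ - expSum y n ∣)
        ≤⟨ Rat.+-monoʳ-≤ q (Rat.+-mono-≤ (middle ∣x∣≤B ∣y∣≤B x≈y)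
             (Rat.≤-trans (Rat.≤-reflexive (∣∣-swap (expSum y n₀) (expSum y n)))
               (tail ∣y∣≤B n₀≤n))) ⟩
      q + (ε * ½ + q)
        ≡⟨ solve 2 (λ q h → q :+ (h :+ q) := (q :+ q) :+ h) refl q (ε * ½) ⟩
      (q + q) + ε * ½    ≡⟨ cong (_+ ε * ½) (halves (ε * ½)) ⟩
      ε * ½ + ε * ½      ≡⟨ halves ε ⟩
      ε ∎

  abstract
    module _ (s t : ℕ → ℚ) (cs : Cauchy s) (ct : Cauchy t) where

      +-cauchy : Cauchy (λ n → s n + t n)
      +-cauchy ε 0<ε
        with N , close ← cs (ε * ½) (half 0<ε)
        with M , close′ ← ct (ε * ½) (half 0<ε) =
        N ℕ.⊔ M , λ m n ≤m ≤n → begin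
          ∣ (s m + t m) - (s n + t n) ∣
            ≡⟨ cong ∣_∣ (solve 4 (λ a b c d → (a :+ b) :- (c :+ d) := (a :- c) :+ (b :- d)) refl
                 (s m) (t m) (s n) (t n)) ⟩
          ∣ (s m - s n) + (t m - t n) ∣    ≤⟨ Rat.∣p+q∣≤∣p∣+∣q∣ (s m - s n) (t m - t n) ⟩
          ∣ s m - s n ∣ + ∣ t m - t n ∣
            ≤⟨ Rat.+-mono-≤
                 (close m n (⊔ˡ N M ≤m) (⊔ˡ N M ≤n))
                 (close′ m n (⊔ʳ N M ≤m) (⊔ʳ N M ≤n)) ⟩
          ε * ½ + ε * ½  ≡⟨ halves ε ⟩
          ε ∎

      *-cauchy : Cauchy (λ n → s n * t n)
      *-cauchy ε 0<ε =
        let B , 0<B , N₁ , ∣s∣≤B = Cauchy⇒bounded cs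
            C , 0<C , N₂ , ∣t∣≤C = Cauchy⇒bounded ct
            r , 0<r , rB≡1 = 1/pos 0<B
            u , 0<u , uC≡1 = 1/pos 0<C
            N₃ , close  = cs (ε * ½ * u) (0<* (half 0<ε) 0<u)
            N₄ , close′ = ct (ε * ½ * r) (0<* (half 0<ε) 0<r)
            N₁₂ = N₁ ℕ.⊔ N₂
            N₃₄ = N₃ ℕ.⊔ N₄
        in N₁₂ ℕ.⊔ N₃₄ , λ m n ≤m ≤n →
             *-close 0<ε 0<B 0<u rB≡1 uC≡1 (s m) (s n) (t m) (t n)
               (∣s∣≤B m (⊔ˡ N₁ N₂ (⊔ˡ N₁₂ N₃₄ ≤m))) (∣t∣≤C n (⊔ʳ N₁ N₂ (⊔ˡ N₁₂ N₃₄ ≤n)))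
               (close m n (⊔ˡ N₃ N₄ (⊔ʳ N₁₂ N₃₄ ≤m)) (⊔ˡ N₃ N₄ (⊔ʳ N₁₂ N₃₄ ≤n)))
               (close′ m n (⊔ʳ N₃ N₄ (⊔ʳ N₁₂ N₃₄ ≤m)) (⊔ʳ N₃ N₄ (⊔ʳ N₁₂ N₃₄ ≤n)))

    module _ (s : ℕ → ℚ) (cs : Cauchy s) where

      neg-cauchy : Cauchy (λ n → - s n)
      neg-cauchy ε 0<ε with N , close ← cs ε 0<ε = N , λ m n ≤m ≤n → begin
        ∣ - s m - - s n ∣
          ≡⟨ cong ∣_∣ (solve 2 (λ a b → :- a :- :- b := b :- a) refl (s m) (s n)) ⟩
        ∣ s n - s m ∣   ≤⟨ close n m ≤n ≤m ⟩
        ε ∎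

      ∣∣-cauchy : Cauchy (λ n → ∣ s n ∣)
      ∣∣-cauchy ε 0<ε with N , close ← cs ε 0<ε = N , λ m n ≤m ≤n →
        Rat.≤-trans (∣∣p∣-∣q∣∣≤∣p-q∣ (s m) (s n)) (close m n ≤m ≤n)

      exp-cauchy : Cauchy (λ n → expSum (s n) n)
      exp-cauchy ε 0<ε =
        let B , 0<B , N₁ , ∣s∣≤B = Cauchy⇒bounded cs
            0≤B = Rat.<⇒≤ 0<B
            K , B+B≤K = archimedean (B + B)
            n₀ , K≤n₀ , T≤ = Tail.T-small 0≤B K B+B≤K (ε * ½ * ½ * ½) (half (half (half 0<ε)))
            r , 0<r , rD≡1 = 1/pos (Rat.+-mono-≤-< (0≤expSum 0≤B n₀) 0<1)
            N₂ , close = cs (ε * ½ * r) (0<* (half 0<ε) 0<r)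
            N₁₂ = N₁ ℕ.⊔ N₂
        in N₁₂ ℕ.⊔ n₀ , λ m n ≤m ≤n →
             exp-close 0<ε 0≤B 0<r B+B≤K K≤n₀ T≤ rD≡1
               (∣s∣≤B m (⊔ˡ N₁ N₂ (⊔ˡ N₁₂ n₀ ≤m))) (∣s∣≤B n (⊔ˡ N₁ N₂ (⊔ˡ N₁₂ n₀ ≤n)))
               (close m n (⊔ʳ N₁ N₂ (⊔ˡ N₁₂ n₀ ≤m)) (⊔ʳ N₁ N₂ (⊔ˡ N₁₂ n₀ ≤n)))
               (⊔ʳ N₁₂ n₀ ≤m) (⊔ʳ N₁₂ n₀ ≤n)

    constant-cauchy : ∀ q → Cauchy (λ _ → q)
    constant-cauchy q ε 0<ε = 0 , λ _ _ _ _ →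
      Rat.≤-trans (Rat.≤-reflexive (cong ∣_∣ (Rat.+-inverseʳ q))) (Rat.<⇒≤ 0<ε)

open Estimates using (Cauchy; Eventually; expSum)

-- Cauchy sequences of rationals, compared up to _≈_ below
record ℝ : Set where
  constructor mkℝ
  field
    seq    : ℕ → ℚ
    cauchy : Cauchy seq

open ℝ public

infix  4 _≤_ _<_ _>_ _≈_
infixl 6 _+_ _-_
infixl 7 _*_ _/_
infix  8 -_

fromℚ : ℚ → ℝ
fromℚ q = mkℝ (λ _ → q) (Estimates.constant-cauchy q)

0ℝ 1ℝ : ℝ
0ℝ = fromℚ 0ℚ
1ℝ = fromℚ 1ℚ

fromℕ : ℕ → ℝ
fromℕ n = fromℚ (ℤ.+ n Rat./ 1)

-- Opaque because Agda's checks normalise types, and unfolding rational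
-- arithmetic on open terms is prohibitively slow.
opaque
  _+_ : ℝ → ℝ → ℝ
  x + y = mkℝ (λ n → seq x n Rat.+ seq y n)
    (Estimates.+-cauchy (seq x) (seq y) (cauchy x) (cauchy y))

  _*_ : ℝ → ℝ → ℝ
  x * y = mkℝ (λ n → seq x n Rat.* seq y n)
    (Estimates.*-cauchy (seq x) (seq y) (cauchy x) (cauchy y))

  -_ : ℝ → ℝ
  - x = mkℝ (λ n → Rat.- seq x n) (Estimates.neg-cauchy (seq x) (cauchy x))

  ∣_∣ : ℝ → ℝ
  ∣ x ∣ = mkℝ (λ n → Rat.∣ seq x n ∣) (Estimates.∣∣-cauchy (seq x) (cauchy x))

  -- The diagonal of the exponential series: the n-th approximation to exp x is
  -- the sum of the first n terms of the series at the n-th approximation to x.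
  exp : ℝ → ℝ
  exp x = mkℝ (λ n → expSum (seq x n) n) (Estimates.exp-cauchy (seq x) (cauchy x))

_-_ : ℝ → ℝ → ℝ
x - y = x + - y

_/_ : ℝ → (k : ℕ) .⦃ _ : NonZero k ⦄ → ℝ
x / k = x * fromℚ (ℤ.+ 1 Rat./ k)

data _≤_ (x y : ℝ) : Set where
  *≤* : (∀ ε → 0ℚ Rat.< ε → Eventually (λ n → seq x n Rat.≤ seq y n Rat.+ ε)) → x ≤ y

data _<_ (x y : ℝ) : Set where
  *<* : ∀ ε → 0ℚ Rat.< ε → Eventually (λ n → seq x n Rat.+ ε Rat.≤ seq y n) → x < y

_>_ _≈_ : Rel ℝ 0ℓ
x > y = y < x
x ≈ y = x ≤ y × y ≤ x

Σ[_] : ∀ {n} → (Fin n → ℝ) → ℝ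
Σ[_] = Vector.foldr _+_ 0ℝ

infix 4 _⟶_

_⟶_ : (ℕ → ℝ) → ℝ → Set
a ⟶ x = ∀ ε → 0ℝ < ε → Eventually (λ k → ∣ a k - x ∣ < ε)

IsInfimum : Pred ℝ 0ℓ → ℝ → Set
IsInfimum S w = (∀ x → S x → w ≤ x) × (∀ ε → 0ℝ < ε → ∃[ x ] S x × x < w + ε)

record Graph (n : ℕ) : Set₁ where
  infix 4 _~_ _~?_
  field
    _~_  : Rel (Fin n) 0ℓ
    _~?_ : Decidable _~_
    sym~ : Symmetric _~_

module _ {n : ℕ} (G : Graph n) where
  open Graph G

  data Walk : ℕ → Rel (Fin n) 0ℓ where
    []  : ∀ {u} → Walk 0 u u
    _∷_ : ∀ {k u v w} → u ~ v → Walk k v w → Walk (suc k) u w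

  walk? : ∀ k → Decidable (Walk k)
  walk? zero    u v = map′ (λ { refl → [] }) (λ { [] → refl }) (u Fin.≟ v)
  walk? (suc k) u w = map′ (λ { (_ , e , p) → e ∷ p }) (λ { (e ∷ p) → _ , e , p })
    (Fin.any? λ v → (u ~? v) ×-dec walk? k v w)

  Connected : Set
  Connected = ∀ u v → ∃[ k ] Walk k u v

  Lipschitz : ℝ → (Fin n → ℝ) → Set
  Lipschitz c f = ∀ u v → u ~ v → ∣ f u - f v ∣ ≤ c

  -- u ∈N v: u lies in the closed neighbourhood N(v)
  _∈N_ : Rel (Fin n) 0ℓ
  u ∈N v = u ≡ v ⊎ v ~ u

Least : Pred ℕ 0ℓ → Pred ℕ 0ℓ
Least P k = P k × (∀ j → P j → k ℕ.≤ j)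

least : ∀ {P : Pred ℕ 0ℓ} → (∀ k → Dec (P k)) → ∀ k → P k → ∃ (Least P)
least P? zero    p = 0 , p , λ _ _ → ℕ.z≤n
least {P} P? (suc k) p with P? 0
... | yes p₀ = 0 , p₀ , λ _ _ → ℕ.z≤n
... | no ¬p₀ with j , q , min ← least {λ i → P (suc i)} (λ i → P? (suc i)) k p =
  suc j , q , λ { zero p₀ → contradiction p₀ ¬p₀ ; (suc i) r → ℕ.s≤s (min i r) }

module _ {n : ℕ} {G : Graph n} (conn : Connected G) where

  shortest : ∀ u v → ∃ (Least (λ k → Walk G k u v))
  shortest u v = least (λ k → walk? G k u v) (proj₁ (conn u v)) (proj₂ (conn u v))

  dist : Fin n → Fin n → ℕ
  dist u v = proj₁ (shortest u v)

  dist-nonZero : ∀ {u v} → u ≢ v → NonZero (dist u v)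
  dist-nonZero {u} {v} u≢v = nonZero (shortest u v)
    where
    nonZero : (s : ∃ (Least (λ k → Walk G k u v))) → NonZero (proj₁ s)
    nonZero (zero  , [] , _) = contradiction refl u≢v
    nonZero (suc _ , _)      = _

module _ {n : ℕ} where

  record IsDistribution (p : Fin n → ℝ) : Set where
    field
      nonNeg : ∀ v → 0ℝ ≤ p v
      total  : Σ[ p ] ≈ 1ℝ

  E : (Fin n → ℝ) → (Fin n → ℝ) → ℝ
  E p f = Σ[ (λ v → p v * f v) ]

  mass : (Fin n → ℝ) → Subset n → ℝ
  mass p S = Σ[ (λ v → if does (v ∈? S) then p v else 0ℝ) ]

  infix 4 _[_]≤_

  -- p [ P ]≤ r: the event P has p-probability at most r.  A predicate on
  -- reals is in general not decidable, so P itself need not be a Subset; we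
  -- bound the mass of every Subset contained in P.  When P is decidable, P is
  -- the largest of these and, p being nonnegative, this says that the sum of
  -- p over P is at most r.
  _[_]≤_ : (Fin n → ℝ) → Pred (Fin n) 0ℓ → ℝ → Set
  p [ P ]≤ r = ∀ (S : Subset n) → (∀ v → v ∈ S → P v) → mass p S ≤ r

  record IsCoupling (p q : Fin n → ℝ) (A : Fin n → Fin n → ℝ) : Set where
    field
      nonNeg    : ∀ x y → 0ℝ ≤ A x y
      ≤1        : ∀ x y → A x y ≤ 1ℝ
      marginalˡ : ∀ x → Σ[ (λ y → A x y) ] ≈ p x
      marginalʳ : ∀ y → Σ[ (λ x → A x y) ] ≈ q y

record RandomWalk {n : ℕ} (G : Graph n) : Set where
  field
    step           : Fin n → Fin n → ℝ
    isDistribution : ∀ v → IsDistribution (step v)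
    supported      : ∀ v u → ¬ (_∈N_ G u v) → step v u ≈ 0ℝ

module _ {n : ℕ} {G : Graph n} (m : RandomWalk G) where
  open RandomWalk m

  evolve : (Fin n → ℝ) → (Fin n → ℝ)
  evolve p y = Σ[ (λ x → p x * step x y) ]

  -- law v k: the distribution after k steps from v
  law : Fin n → ℕ → (Fin n → ℝ)
  law v zero    u = if does (u Fin.≟ v) then 1ℝ else 0ℝ
  law v (suc k) = evolve (law v k)

  record IsInvariant (ν : Fin n → ℝ) : Set where
    field
      isDistribution : IsDistribution ν
      invariant      : ∀ y → evolve ν y ≈ ν y

  record IsErgodic (ν : Fin n → ℝ) : Set where
    field
      isInvariant : IsInvariant ν
      unique      : ∀ ν′ → IsInvariant ν′ → ∀ y → ν′ y ≈ ν y
      converges   : ∀ v y → (λ k → law v k y) ⟶ ν y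

module _ {n : ℕ} {G : Graph n} (conn : Connected G) where

  cost : (Fin n → Fin n → ℝ) → ℝ
  cost A = Σ[ (λ x → Σ[ (λ y → A x y * fromℕ (dist conn x y)) ]) ]

  -- W(p , q) = w
  IsTransportationDistance : (p q : Fin n → ℝ) → ℝ → Set
  IsTransportationDistance p q =
    IsInfimum (λ c → ∃[ A ] IsCoupling p q A × c ≈ cost A)

  module _ (m : RandomWalk G) where
    open RandomWalk m

    -- κ(x , y) = k
    IsCurvature : ∀ x y → x ≢ y → ℝ → Set
    IsCurvature x y x≢y k = ∃[ w ] IsTransportationDistance (step x) (step y) w ×
      k ≈ 1ℝ - w / dist conn x y
      where instance _ = dist-nonZero conn x≢y

    -- That the infimum defining κ(x , y) is a real number is classically
    -- automatic; here it is part of the condition.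
    CurvatureAtLeast : ℝ → Set
    CurvatureAtLeast κ₀ = ∀ x y (x≢y : x ≢ y) → ∃[ k ] IsCurvature x y x≢y k × κ₀ ≤ k

{-# OPTIONS --safe #-}

-- Write r = 1 - κ and let M g x be the mean of g after one step from x.  Pairing the
-- values of g along almost optimal couplings shows that M maps L-Lipschitz
-- functions to (L r)-Lipschitz ones, so M^k f is r^k-Lipschitz and tends to the constant
-- E f.  Neighbours differ by at most L under g, whence
-- M (exp (l g)) ≤ exp (l² L) exp (l M g) for 0 ≤ l ≤ 1/3.  Iterating k times and using
-- that ν is invariant, E exp (l f) ≤ exp (l² Σ_{i<k} r^i) E exp (l M^k f), where
-- κ Σ_{i<k} r^i ≤ 1, and Chernoff's bound at l = t κ / 4 gives the claim.  Summing
-- M^i f - M^(i+1) f ≤ r^i shows that no vertex deviates by much more than 1/κ, so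
-- this l is admissible whenever the event is nonempty; that event also
-- supplies two distinct vertices, hence κ ≤ 1.
-- The constants leave slack, so some finite k suffices and no limit is taken.

module Submission where

open import Algebra using (CommutativeRing; IsCommutativeRing; Congruent₂)
import Algebra.Consequences.Setoid as Consequences
import Algebra.Properties.Semiring.Sum
import Algebra.Solver.Ring
open import Algebra.Solver.Ring.AlmostCommutativeRing
  using (fromCommutativeRing; _-Raw-AlmostCommutative⟶_)
open import Data.Bool using (if_then_else_)
open import Data.Fin using (Fin; zero; suc)
import Data.Fin.Properties as Fin
open import Data.Fin.Subset using (Subset; _∈_; Nonempty)
open import Data.Fin.Subset.Properties using (_∈?_; nonempty?)
import Data.Integer as ℤ
open import Data.Maybe using (Maybe; just; nothing)
open import Data.Nat as ℕ using (ℕ; zero; suc; z≤n; s≤s; NonZero)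
import Data.Nat.Properties as ℕ
open import Data.Product using (_×_; _,_; ∃-syntax; proj₁; proj₂)
open import Data.Rational as Rat using (ℚ; 0ℚ; 1ℚ; ½)
import Data.Rational.Properties as ℚ
import Data.Rational.Solver as ℚSolver
open import Data.Sum using (_⊎_; inj₁; inj₂)
open import Function using (_∘_)
open import Level using (0ℓ)
open import Relation.Binary using (IsEquivalence; Poset; Setoid)
open import Relation.Binary.PropositionalEquality
  using (_≡_; _≢_; refl; sym; trans; cong; cong₂; subst; subst₂)
open import Relation.Nullary using (¬_; Dec; yes; no; does; contradiction; ¬?)
open import Relation.Nullary.Decidable using (_⊎-dec_; from-yes; decidable-stable)
open import Relation.Unary using (Pred)
import Defs

-- The order on these reals is not decidable, there is no division by a real, and `exp` is known
-- only through partial sums. So only a few facts about `exp` are used (the functional equation, 1 +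
-- x ≤ exp x, and exp x ≤ 1 + x + x² near 0), each traced back to partial sums at rationals, and
-- bounds of size 1/κ are stated after multiplication by κ. The one-step estimate gives up l² L
-- where l² L² would hold, so that its errors add up to the same Σ r^i that bounds the deviation of
-- a vertex. The constants: l²/κ - l t is least at l = t κ / 2, but the deviation bound κ (f v - E
-- f) ≤ 9/8 only keeps this below 9/16, outside the range |x| ≤ ½ of the quadratic bound. At l = t κ
-- / 4, which is at most 9/32, the exponent is -3/16 t² κ. Approximating the mean up to 1/8 costs at
-- most 1/32 t² κ because t ≥ 1, and the remaining 5/32 exceeds 1/7.

module Series where
  open import Data.Rational using (ℚ; nonNegative; 0ℚ; 1ℚ; ½; _+_; _*_; _-_; -_; ∣_∣; _≤_; _<_)
  open Defs.Estimates
  open ℚ.≤-Reasoning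
  open ℚSolver.+-*-Solver using (solve; _:=_; _:+_; _:*_; _:-_; :-_; con)

  -- Rational inequalities behind the ε-estimates

  *-monoˡ : ∀ {p q r} → 0ℚ ≤ r → p ≤ q → r * p ≤ r * q
  *-monoˡ {r = r} 0≤r = ℚ.*-monoˡ-≤-nonNeg r ⦃ nonNegative 0≤r ⦄

  p≤q⇒0≤q-p : ∀ {p q} → p ≤ q → 0ℚ ≤ q - p
  p≤q⇒0≤q-p {p} {q} p≤q = subst (_≤ q - p) (ℚ.+-inverseʳ p) (ℚ.+-monoˡ-≤ (- p) p≤q)

  p≤∣p∣ : ∀ p → p ≤ ∣ p ∣
  p≤∣p∣ p with ℚ.≤-total 0ℚ p
  ... | inj₁ 0≤p = ℚ.≤-reflexive (sym (ℚ.0≤p⇒∣p∣≡p 0≤p))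
  ... | inj₂ p≤0 = ℚ.≤-trans p≤0 (ℚ.0≤∣p∣ p)

  0≤p*p : ∀ p → 0ℚ ≤ p * p
  0≤p*p p with ℚ.≤-total 0ℚ p
  ... | inj₁ 0≤p = 0≤* 0≤p 0≤p
  ... | inj₂ p≤0 = subst (0ℚ ≤_) (solve 1 (λ p → :- p :* :- p := p :* p) refl p)
    (0≤* (ℚ.neg-antimono-≤ p≤0) (ℚ.neg-antimono-≤ p≤0))

  ∣∣-bound : ∀ {p q} → - q ≤ p → p ≤ q → ∣ p ∣ ≤ q
  ∣∣-bound {p} {q} -q≤p p≤q with ℚ.∣p∣≡p∨∣p∣≡-p p
  ... | inj₁ eq = subst (_≤ q) (sym eq) p≤q
  ... | inj₂ eq = subst₂ _≤_ (sym eq) (solve 1 (λ q → :- :- q := q) refl q)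
    (ℚ.neg-antimono-≤ -q≤p)

  quotient : ∀ {p q} → 0ℚ < p → 0ℚ < q → ∃[ r ] 0ℚ < r × r * q ≡ p
  quotient {p} {q} 0<p 0<q =
    let s , 0<s , sq≡1 = 1/pos 0<q
    in p * s , 0<* 0<p 0<s , trans (ℚ.*-assoc p s q) (trans (cong (p *_) sq≡1) (ℚ.*-identityʳ p))

  ∣p-q∣≤ε⇒p≤q+ε : ∀ {p q ε} → ∣ p - q ∣ ≤ ε → p ≤ q + ε
  ∣p-q∣≤ε⇒p≤q+ε {p} {q} {ε} le = subst (_≤ q + ε)
    (solve 2 (λ p q → q :+ (p :- q) := p) refl p q)
    (ℚ.+-monoʳ-≤ q (ℚ.≤-trans (p≤∣p∣ (p - q)) le))

  -- p q = (p + η) (q + ζ) - (p + η) ζ - η q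
  product-lower : ∀ {ε η ζ B C p q} → 0ℚ < η → 0ℚ < ζ → ζ * (B + η) ≡ ε * ½ → η * C ≡ ε * ½ →
    ∣ p ∣ ≤ B → ∣ q ∣ ≤ C → 0ℚ ≤ p + η → 0ℚ ≤ q + ζ → 0ℚ ≤ p * q + ε
  product-lower {ε} {η} {ζ} {B} {C} {p} {q} 0<η 0<ζ ζB≡½ε ηC≡½ε ∣p∣≤B ∣q∣≤C 0≤p+η 0≤q+ζ = begin
    0ℚ
      ≤⟨ ℚ.+-mono-≤ (ℚ.+-mono-≤ (0≤* 0≤p+η 0≤q+ζ)
           (0≤* (ℚ.<⇒≤ 0<ζ) (p≤q⇒0≤q-p (ℚ.≤-trans (p≤∣p∣ p) ∣p∣≤B))))
           (0≤* (ℚ.<⇒≤ 0<η) (p≤q⇒0≤q-p (ℚ.≤-trans (p≤∣p∣ q) ∣q∣≤C))) ⟩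
    (p + η) * (q + ζ) + ζ * (B - p) + η * (C - q)
      ≡⟨ solve 6 (λ p q η ζ B C →
           (p :+ η) :* (q :+ ζ) :+ ζ :* (B :- p) :+ η :* (C :- q)
           := p :* q :+ (ζ :* (B :+ η) :+ η :* C)) refl p q η ζ B C ⟩
    p * q + (ζ * (B + η) + η * C)    ≡⟨ cong₂ (λ u v → p * q + (u + v)) ζB≡½ε ηC≡½ε ⟩
    p * q + (ε * ½ + ε * ½)          ≡⟨ cong (p * q +_) (halves ε) ⟩
    p * q + ε ∎

  product-close : ∀ {ε η C p q s} → 0ℚ < η → η * C ≡ ε →
    p ≤ q + η → q ≤ p + η → ∣ s ∣ ≤ C → p * s ≤ q * s + ε
  product-close {ε} {η} {C} {p} {q} {s} 0<η ηC≡ε p≤q+η q≤p+η ∣s∣≤C =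
    ∣p-q∣≤ε⇒p≤q+ε (begin
      ∣ p * s - q * s ∣      ≡⟨ cong ∣_∣ (solve 3 (λ p q s → p :* s :- q :* s := (p :- q) :* s) refl p q s) ⟩
      ∣ (p - q) * s ∣        ≡⟨ ℚ.∣p*q∣≡∣p∣*∣q∣ (p - q) s ⟩
      ∣ p - q ∣ * ∣ s ∣      ≤⟨ *-mono-≤ (ℚ.0≤∣p∣ s) (ℚ.<⇒≤ 0<η) (∣∣-bound lower upper) ∣s∣≤C ⟩
      η * C                 ≡⟨ ηC≡ε ⟩
      ε                     ∎)
    where
    lower : - η ≤ p - q
    lower = subst₂ _≤_ (solve 3 (λ p q η → q :- (q :+ η) := :- η) refl p q η)
      (solve 3 (λ p q η → p :+ η :- (q :+ η) := p :- q) refl p q η)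
      (ℚ.+-monoˡ-≤ (- (q + η)) q≤p+η)
    upper : p - q ≤ η
    upper = subst (p - q ≤_) (solve 2 (λ q η → q :+ η :- q := η) refl q η)
      (ℚ.+-monoˡ-≤ (- q) p≤q+η)

  -- The Cauchy product of two exponential series

  -- Peeling off a first term leaves a shifted sequence, which `expSum` cannot express; hence sums
  -- of arbitrary sequences.
  sum : (ℕ → ℚ) → ℕ → ℚ
  sum a zero    = 0ℚ
  sum a (suc n) = sum a n + a n

  expSum≡sum : ∀ x n → expSum x n ≡ sum (expTerm x) n
  expSum≡sum x zero    = refl
  expSum≡sum x (suc n) = cong (_+ expTerm x n) (expSum≡sum x n)

  sum-front : ∀ a n → sum a (suc n) ≡ a 0 + sum (a ∘ suc) n
  sum-front a zero    = ℚ.+-comm 0ℚ (a 0)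
  sum-front a (suc n) = trans (cong (_+ a (suc n)) (sum-front a n)) (ℚ.+-assoc (a 0) _ _)

  0≤sum : ∀ {a} → (∀ i → 0ℚ ≤ a i) → ∀ n → 0ℚ ≤ sum a n
  0≤sum 0≤a zero    = ℚ.≤-refl
  0≤sum 0≤a (suc n) = ℚ.+-mono-≤ (0≤sum 0≤a n) (0≤a n)

  conv : (a b : ℕ → ℚ) → ℕ → ℚ
  conv a b zero    = a 0 * b 0
  conv a b (suc n) = a 0 * b (suc n) + conv (a ∘ suc) b n

  conv-+ˡ : ∀ {a a′ c} → (∀ i → c i ≡ a i + a′ i) →
    ∀ b n → conv c b n ≡ conv a b n + conv a′ b n
  conv-+ˡ {a} {a′} c≡ b zero    = trans (cong (_* b 0) (c≡ 0)) (ℚ.*-distribʳ-+ (b 0) (a 0) (a′ 0))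
  conv-+ˡ {a} {a′} c≡ b (suc n) = trans
    (cong₂ (λ u v → u * b (suc n) + v) (c≡ 0) (conv-+ˡ (c≡ ∘ suc) b n))
    (solve 5 (λ a a′ b u v → (a :+ a′) :* b :+ (u :+ v) := (a :* b :+ u) :+ (a′ :* b :+ v)) refl
      (a 0) (a′ 0) (b (suc n)) _ _)

  conv-*ˡ : ∀ {a c} x → (∀ i → c i ≡ a i * x) → ∀ b n → conv c b n ≡ conv a b n * x
  conv-*ˡ {a} x c≡ b zero    = trans (cong (_* b 0) (c≡ 0))
    (solve 3 (λ a b x → a :* x :* b := a :* b :* x) refl (a 0) (b 0) x)
  conv-*ˡ {a} x c≡ b (suc n) = trans
    (cong₂ (λ u v → u * b (suc n) + v) (c≡ 0) (conv-*ˡ x (c≡ ∘ suc) b n))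
    (solve 4 (λ a b x u → a :* x :* b :+ u :* x := (a :* b :+ u) :* x) refl
      (a 0) (b (suc n)) x _)

  conv-*ʳ : ∀ {b c} x → (∀ i → c i ≡ b i * x) → ∀ a n → conv a c n ≡ conv a b n * x
  conv-*ʳ {b} x c≡ a zero    = trans (cong (a 0 *_) (c≡ 0)) (sym (ℚ.*-assoc (a 0) (b 0) x))
  conv-*ʳ {b} x c≡ a (suc n) = trans
    (cong₂ (λ u v → a 0 * u + v) (c≡ (suc n)) (conv-*ʳ x c≡ (a ∘ suc) n))
    (solve 4 (λ a b x u → a :* (b :* x) :+ u :* x := (a :* b :+ u) :* x) refl
      (a 0) (b (suc n)) x _)

  -- The recursion of `conv` splits off the first index of `a`. This splits off the other end, where
  -- a factor `θ b` contributes nothing because it vanishes at index 0.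
  conv-back : ∀ a b n → conv a b (suc n) ≡ conv a (b ∘ suc) n + a (suc n) * b 0
  conv-back a b zero    = refl
  conv-back a b (suc n) = trans
    (cong (a 0 * b (suc (suc n)) +_) (conv-back (a ∘ suc) b n))
    (sym (ℚ.+-assoc (a 0 * b (suc (suc n))) _ _))

  -- The Euler operator, a derivation of the convolution product
  θ : (ℕ → ℚ) → ℕ → ℚ
  θ a i = fromℕ i * a i

  -- Every product `a i * b j` in the coefficient has i + j = n, so the weights i and j given by the
  -- two summands add up to n.
  θ-conv : ∀ a b n → conv (θ a) b n + conv a (θ b) n ≡ fromℕ n * conv a b n
  θ-conv a b zero = solve 2
    (λ a b → con 0ℚ :* a :* b :+ a :* (con 0ℚ :* b) := con 0ℚ :* (a :* b)) refl (a 0) (b 0)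
  θ-conv a b (suc n) = begin-equality
    (0ℚ * a 0 * b′ + conv (θ a ∘ suc) b n) + (a 0 * (fromℕ (suc n) * b′) + conv a′ (θ b) n)
      ≡⟨ cong₂ (λ u s → (0ℚ * a 0 * b′ + u) + (a 0 * (s * b′) + conv a′ (θ b) n))
           (conv-+ˡ θ-suc b n) (fromℕ-suc n) ⟩
    (0ℚ * a 0 * b′ + (conv (θ a′) b n + conv a′ b n))
      + (a 0 * ((fromℕ n + 1ℚ) * b′) + conv a′ (θ b) n)
      ≡⟨ solve 6 (λ a b f u v w →
           (con 0ℚ :* a :* b :+ (u :+ v)) :+ (a :* ((f :+ con 1ℚ) :* b) :+ w)
           := (f :+ con 1ℚ) :* (a :* b) :+ (v :+ (u :+ w))) refl
           (a 0) b′ (fromℕ n) (conv (θ a′) b n) (conv a′ b n) (conv a′ (θ b) n) ⟩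
    (fromℕ n + 1ℚ) * (a 0 * b′) + (conv a′ b n + (conv (θ a′) b n + conv a′ (θ b) n))
      ≡⟨ cong (λ u → (fromℕ n + 1ℚ) * (a 0 * b′) + (conv a′ b n + u)) (θ-conv a′ b n) ⟩
    (fromℕ n + 1ℚ) * (a 0 * b′) + (conv a′ b n + fromℕ n * conv a′ b n)
      ≡⟨ solve 3 (λ f u v → (f :+ con 1ℚ) :* u :+ (v :+ f :* v) := (f :+ con 1ℚ) :* (u :+ v))
           refl (fromℕ n) (a 0 * b′) (conv a′ b n) ⟩
    (fromℕ n + 1ℚ) * (a 0 * b′ + conv a′ b n)
      ≡⟨ cong (_* (a 0 * b′ + conv a′ b n)) (fromℕ-suc n) ⟨
    fromℕ (suc n) * (a 0 * b′ + conv a′ b n) ∎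
    where
    a′ = a ∘ suc
    b′ = b (suc n)
    θ-suc : ∀ i → θ a (suc i) ≡ θ a′ i + a′ i
    θ-suc i = trans (cong (_* a′ i) (fromℕ-suc i))
      (solve 2 (λ f a → (f :+ con 1ℚ) :* a := f :* a :+ a) refl (fromℕ i) (a′ i))

  module _ (x y : ℚ) where
    private
      a = expTerm x
      b = expTerm y

    -- θ (expTerm x) is the shift of expTerm x by one, times x.
    conv-expTerm : ∀ n → conv a b n ≡ expTerm (x + y) n
    conv-expTerm zero    = refl
    conv-expTerm (suc n) = begin-equality
      c                                       ≡⟨ ℚ.*-identityʳ c ⟨
      c * 1ℚ                                  ≡⟨ cong (c *_) (1/suc-inverse n) ⟨
      c * (1/suc n * fromℕ (suc n))
        ≡⟨ solve 3 (λ c r f → c :* (r :* f) := (f :* c) :* r) refl c (1/suc n) (fromℕ (suc n)) ⟩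
      fromℕ (suc n) * c * 1/suc n             ≡⟨ cong (_* 1/suc n) (θ-conv a b (suc n)) ⟨
      (conv (θ a) b (suc n) + conv a (θ b) (suc n)) * 1/suc n
        ≡⟨ cong (λ u → (0ℚ * 1ℚ * b (suc n) + conv (θ a ∘ suc) b n + u) * 1/suc n)
             (conv-back a (θ b) n) ⟩
      (0ℚ * 1ℚ * b (suc n) + conv (θ a ∘ suc) b n
        + (conv a (θ b ∘ suc) n + a (suc n) * (0ℚ * 1ℚ))) * 1/suc n
        ≡⟨ cong₂ (λ u v → (0ℚ * 1ℚ * b (suc n) + u + (v + a (suc n) * (0ℚ * 1ℚ))) * 1/suc n)
             (conv-*ˡ x (expTerm-suc x) b n) (conv-*ʳ y (expTerm-suc y) a n) ⟩
      (0ℚ * 1ℚ * b (suc n) + conv a b n * x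
        + (conv a b n * y + a (suc n) * (0ℚ * 1ℚ))) * 1/suc n
        ≡⟨ solve 6 (λ a b c x y r →
             (con 0ℚ :* con 1ℚ :* b :+ c :* x :+ (c :* y :+ a :* (con 0ℚ :* con 1ℚ))) :* r
             := c :* (x :+ y) :* r) refl (a (suc n)) (b (suc n)) (conv a b n) x y (1/suc n) ⟩
      conv a b n * (x + y) * 1/suc n
        ≡⟨ cong (λ u → u * (x + y) * 1/suc n) (conv-expTerm n) ⟩
      expTerm (x + y) n * (x + y) * 1/suc n   ∎
      where c = conv a b (suc n)

  -- The sum of a i * b j over i + j < n
  triangle : (a b : ℕ → ℚ) → ℕ → ℚ
  triangle a b zero    = 0ℚ
  triangle a b (suc n) = a 0 * sum b (suc n) + triangle (a ∘ suc) b n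

  triangle-suc : ∀ a b n → triangle a b (suc n) ≡ triangle a b n + conv a b n
  triangle-suc a b zero    =
    solve 2 (λ a b → a :* (con 0ℚ :+ b) :+ con 0ℚ := con 0ℚ :+ a :* b) refl (a 0) (b 0)
  triangle-suc a b (suc n) = trans
    (cong (a 0 * (sum b (suc n) + b (suc n)) +_) (triangle-suc (a ∘ suc) b n))
    (solve 5 (λ a s b u v → a :* (s :+ b) :+ (u :+ v) := (a :* s :+ u) :+ (a :* b :+ v)) refl
      (a 0) (sum b (suc n)) (b (suc n)) (triangle (a ∘ suc) b n) (conv (a ∘ suc) b n))

  triangle-expTerm : ∀ x y n → triangle (expTerm x) (expTerm y) n ≡ expSum (x + y) n
  triangle-expTerm x y zero    = refl
  triangle-expTerm x y (suc n) = trans (triangle-suc (expTerm x) (expTerm y) n)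
    (cong₂ _+_ (triangle-expTerm x y n) (conv-expTerm x y n))

  gap-suc : ∀ a b n m →
    sum a (suc n) * sum b m - triangle a b (suc n)
    ≡ a 0 * (sum b m - sum b (suc n)) + (sum (a ∘ suc) n * sum b m - triangle (a ∘ suc) b n)
  gap-suc a b n m = trans
    (cong (λ u → u * sum b m - triangle a b (suc n)) (sum-front a n))
    (solve 5 (λ a s b₁ b₂ t → (a :+ s) :* b₁ :- (a :* b₂ :+ t)
                           := a :* (b₁ :- b₂) :+ (s :* b₁ :- t)) refl
      (a 0) (sum (a ∘ suc) n) (sum b m) (sum b (suc n)) (triangle (a ∘ suc) b n))

  -- The gap is the sum over i < n of `a i` times the part of `b` between n - i and m, and each of
  -- these products is dominated separately. Shifting `a` lowers n while m stays fixed, so the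
  -- induction needs two lengths.
  gap-majorant : ∀ {a A b B : ℕ → ℚ} → (∀ i → ∣ a i ∣ ≤ A i) → ∀ m →
    (∀ n → n ℕ.≤ m → ∣ sum b m - sum b n ∣ ≤ sum B m - sum B n) → ∀ n → n ℕ.≤ m →
    ∣ sum a n * sum b m - triangle a b n ∣ ≤ sum A n * sum B m - triangle A B n
  gap-majorant {a} {A} {b} {B} ∣a∣≤A m tail zero _ = ℚ.≤-reflexive (trans
    (cong ∣_∣ (solve 1 (λ s → con 0ℚ :* s :- con 0ℚ := con 0ℚ) refl (sum b m)))
    (solve 1 (λ s → con 0ℚ := con 0ℚ :* s :- con 0ℚ) refl (sum B m)))
  gap-majorant {a} {A} {b} {B} ∣a∣≤A m tail (suc n) n<m = begin
    ∣ sum a (suc n) * sum b m - triangle a b (suc n) ∣  ≡⟨ cong ∣_∣ (gap-suc a b n m) ⟩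
    ∣ a 0 * (sum b m - sum b (suc n)) + g ∣            ≤⟨ ℚ.∣p+q∣≤∣p∣+∣q∣ (a 0 * (sum b m - sum b (suc n))) g ⟩
    ∣ a 0 * (sum b m - sum b (suc n)) ∣ + ∣ g ∣
      ≡⟨ cong (_+ ∣ g ∣) (ℚ.∣p*q∣≡∣p∣*∣q∣ (a 0) (sum b m - sum b (suc n))) ⟩
    ∣ a 0 ∣ * ∣ sum b m - sum b (suc n) ∣ + ∣ g ∣
      ≤⟨ ℚ.+-mono-≤
           (*-mono-≤ (ℚ.0≤∣p∣ (sum b m - sum b (suc n))) (ℚ.≤-trans (ℚ.0≤∣p∣ (a 0)) (∣a∣≤A 0)) (∣a∣≤A 0) (tail (suc n) n<m))
           (gap-majorant (∣a∣≤A ∘ suc) m tail n (ℕ.<⇒≤ n<m)) ⟩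
    A 0 * (sum B m - sum B (suc n)) + (sum (A ∘ suc) n * sum B m - triangle (A ∘ suc) B n)
      ≡⟨ gap-suc A B n m ⟨
    sum A (suc n) * sum B m - triangle A B (suc n) ∎
    where g = sum (a ∘ suc) n * sum b m - triangle (a ∘ suc) b n

  sum-mono : ∀ {a} → (∀ i → 0ℚ ≤ a i) → ∀ m j → sum a m ≤ sum a (j ℕ.+ m)
  sum-mono         0≤a m zero    = ℚ.≤-refl
  sum-mono {a = a} 0≤a m (suc j) = ℚ.≤-trans (sum-mono 0≤a m j)
    (subst (_≤ sum a (suc j ℕ.+ m)) (ℚ.+-identityʳ (sum a (j ℕ.+ m)))
      (ℚ.+-monoʳ-≤ (sum a (j ℕ.+ m)) (0≤a (j ℕ.+ m))))

  0≤triangle : ∀ {a b} → (∀ i → 0ℚ ≤ a i) → (∀ i → 0ℚ ≤ b i) → ∀ n → 0ℚ ≤ triangle a b n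
  0≤triangle 0≤a 0≤b zero    = ℚ.≤-refl
  0≤triangle 0≤a 0≤b (suc n) =
    ℚ.+-mono-≤ (0≤* (0≤a 0) (0≤sum 0≤b (suc n))) (0≤triangle (0≤a ∘ suc) 0≤b n)

  -- Indices i < n and j < m satisfy i + j < n + m, and the other terms of the triangle are
  -- nonnegative.
  sum*sum≤triangle : ∀ {a b} → (∀ i → 0ℚ ≤ a i) → (∀ i → 0ℚ ≤ b i) → ∀ n m →
    sum a n * sum b m ≤ triangle a b (n ℕ.+ m)
  sum*sum≤triangle {b = b} 0≤a 0≤b zero m =
    subst (_≤ triangle _ b m) (sym (ℚ.*-zeroˡ (sum b m))) (0≤triangle 0≤a 0≤b m)
  sum*sum≤triangle {a} {b} 0≤a 0≤b (suc n) m = begin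
    sum a (suc n) * sum b m                  ≡⟨ cong (_* sum b m) (sum-front a n) ⟩
    (a 0 + sum (a ∘ suc) n) * sum b m        ≡⟨ ℚ.*-distribʳ-+ (sum b m) (a 0) _ ⟩
    a 0 * sum b m + sum (a ∘ suc) n * sum b m
      ≤⟨ ℚ.+-mono-≤ (*-monoˡ (0≤a 0) (sum-mono 0≤b m (suc n)))
           (sum*sum≤triangle (0≤a ∘ suc) 0≤b n m) ⟩
    a 0 * sum b (suc n ℕ.+ m) + triangle (a ∘ suc) b (n ℕ.+ m) ∎

  -- The missing terms of the Cauchy product are dominated by those at B, which
  -- are part of the tail of the series at B + B.
  expSum-product : ∀ {B x y} → 0ℚ ≤ B → ∣ x ∣ ≤ B → ∣ y ∣ ≤ B → ∀ n →
    ∣ expSum x n * expSum y n - expSum (x + y) n ∣ ≤ expSum (B + B) (n ℕ.+ n) - expSum (B + B) n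
  expSum-product {B} {x} {y} 0≤B ∣x∣≤B ∣y∣≤B n = begin
    ∣ expSum x n * expSum y n - expSum (x + y) n ∣
      ≡⟨ cong₂ (λ u v → ∣ u - v ∣) (cong₂ _*_ (expSum≡sum x n) (expSum≡sum y n))
           (sym (triangle-expTerm x y n)) ⟩
    ∣ sum t n * sum u n - triangle t u n ∣
      ≤⟨ gap-majorant (∣expTerm∣ 0≤B ∣x∣≤B) n tail n ℕ.≤-refl ⟩
    sum T n * sum T n - triangle T T n
      ≤⟨ ℚ.+-monoˡ-≤ (- triangle T T n) (sum*sum≤triangle 0≤T 0≤T n n) ⟩
    triangle T T (n ℕ.+ n) - triangle T T n
      ≡⟨ cong₂ _-_ (triangle-expTerm B B (n ℕ.+ n)) (triangle-expTerm B B n) ⟩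
    expSum (B + B) (n ℕ.+ n) - expSum (B + B) n ∎
    where
    t = expTerm x
    u = expTerm y
    T = expTerm B
    0≤T = 0≤expTerm 0≤B
    tail : ∀ m → m ℕ.≤ n → ∣ sum u n - sum u m ∣ ≤ sum T n - sum T m
    tail m m≤n = subst₂ _≤_
      (cong₂ (λ a b → ∣ a - b ∣) (expSum≡sum y n) (expSum≡sum y m))
      (cong₂ _-_ (expSum≡sum B n) (expSum≡sum B m))
      (subst (λ k → ∣ expSum y k - expSum y m ∣ ≤ expSum B k - expSum B m) (ℕ.m∸n+n≡m m≤n)
        (∣expSum-tail∣ 0≤B ∣y∣≤B m (n ℕ.∸ m)))

  -- Polynomial bounds for the partial sums

  *1/suc≤1 : ∀ {q} k → q ≤ fromℕ (suc k) → q * 1/suc k ≤ 1ℚ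
  *1/suc≤1 {q} k q≤ = begin
    q * 1/suc k                ≤⟨ ℚ.*-monoʳ-≤-nonNeg (1/suc k) ⦃ nonNegative (0≤1/suc k) ⦄ q≤ ⟩
    fromℕ (suc k) * 1/suc k    ≡⟨ ℚ.*-comm (fromℕ (suc k)) (1/suc k) ⟩
    1/suc k * fromℕ (suc k)    ≡⟨ 1/suc-inverse k ⟩
    1ℚ ∎

  module _ {q : ℚ} where
    private
      T = expTerm q
      S = expSum q

    -- For -1 ≤ q, an even term dominates the odd one that follows it.
    1+q≤expSum : - 1ℚ ≤ q → ∀ n → 1ℚ + q ≤ S (2 ℕ.+ n)
    1+q≤expSum -1≤q n with even n
      where
      Good : ℕ → Set
      Good n = 0ℚ ≤ T n × 1ℚ + q ≤ S n

      next-even : ∀ n → Good n → Good (2 ℕ.+ n)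
      next-even n (0≤T , 1+q≤S) =
        subst (0ℚ ≤_) (solve 4 (λ t q r s → t :* (q :* q) :* (r :* s) := t :* q :* r :* q :* s) refl
            (T n) q (1/suc n) (1/suc (suc n)))
          (0≤* (0≤* 0≤T (0≤p*p q)) (0≤* (0≤1/suc n) (0≤1/suc (suc n))))
        , (begin
          1ℚ + q                                ≤⟨ 1+q≤S ⟩
          S n                                   ≡⟨ ℚ.+-identityʳ (S n) ⟨
          S n + 0ℚ                              ≤⟨ ℚ.+-monoʳ-≤ (S n) (0≤* 0≤T 0≤1+qr) ⟩
          S n + T n * (q * 1/suc n - - 1ℚ)
            ≡⟨ solve 4 (λ s t q r → s :+ t :* (q :* r :- :- con 1ℚ) := s :+ t :+ t :* q :* r) refl
                 (S n) (T n) q (1/suc n) ⟩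
          S n + T n + T n * q * 1/suc n         ∎)
        where
        0≤1+qr : 0ℚ ≤ q * 1/suc n - - 1ℚ
        0≤1+qr = p≤q⇒0≤q-p (begin
          - 1ℚ
            ≤⟨ ℚ.neg-antimono-≤ (*1/suc≤1 n (fromℕ-mono {1} {suc n} (s≤s z≤n))) ⟩
          - (1ℚ * 1/suc n)  ≡⟨ solve 1 (λ r → :- (con 1ℚ :* r) := :- con 1ℚ :* r) refl (1/suc n) ⟩
          - 1ℚ * 1/suc n
            ≤⟨ ℚ.*-monoʳ-≤-nonNeg (1/suc n) ⦃ nonNegative (0≤1/suc n) ⦄ -1≤q ⟩
          q * 1/suc n ∎)

      good₂ : Good 2
      good₂ =
        subst (0ℚ ≤_) (solve 1 (λ q → q :* q :* con ½ := con 1ℚ :* q :* con 1ℚ :* q :* con ½) refl q)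
          (0≤* (0≤p*p q) (ℚ.<⇒≤ 0<½))
        , ℚ.≤-reflexive (solve 1 (λ q → con 1ℚ :+ q
             := con 0ℚ :+ con 1ℚ :+ con 1ℚ :* q :* con 1ℚ) refl q)

      -- One of two consecutive lengths is even. The invariant holds there, and an odd length only
      -- adds one more nonnegative term of even degree.
      even : ∀ n → Good (2 ℕ.+ n) ⊎ Good (1 ℕ.+ n)
      even zero    = inj₁ good₂
      even (suc n) with even n
      ... | inj₁ good = inj₂ good
      ... | inj₂ good = inj₁ (next-even (1 ℕ.+ n) good)
    ... | inj₁ (_ , 1+q≤S)   = 1+q≤S
    ... | inj₂ (0≤T , 1+q≤S) = ℚ.≤-trans 1+q≤S
      (subst (_≤ S (2 ℕ.+ n)) (ℚ.+-identityʳ (S (1 ℕ.+ n))) (ℚ.+-monoʳ-≤ (S (1 ℕ.+ n)) 0≤T))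

    -- From degree 1 on, each term has at most half the absolute value of its predecessor. So the
    -- partial sum plus twice the absolute value of the first omitted term never increases, and at
    -- length 2 it equals 1 + q + q².
    expSum≤1+q+q² : ∣ q ∣ ≤ 1ℚ → ∀ n → S (2 ℕ.+ n) ≤ 1ℚ + q + q * q
    expSum≤1+q+q² ∣q∣≤1 n = begin
      S (2 ℕ.+ n)                  ≡⟨ ℚ.+-identityʳ (S (2 ℕ.+ n)) ⟨
      S (2 ℕ.+ n) + 0ℚ
        ≤⟨ ℚ.+-monoʳ-≤ (S (2 ℕ.+ n)) (ℚ.+-mono-≤ (ℚ.0≤∣p∣ (T (2 ℕ.+ n))) (ℚ.0≤∣p∣ (T (2 ℕ.+ n)))) ⟩
      S (2 ℕ.+ n) + (∣ T (2 ℕ.+ n) ∣ + ∣ T (2 ℕ.+ n) ∣)    ≤⟨ bound n ⟩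
      1ℚ + q + q * q ∎
      where
      ∣T∣-halves : ∀ n → ∣ T (2 ℕ.+ n) ∣ + ∣ T (2 ℕ.+ n) ∣ ≤ ∣ T (1 ℕ.+ n) ∣
      ∣T∣-halves n = begin
        ∣ t * q * r ∣ + ∣ t * q * r ∣    ≡⟨ cong (λ u → u + u) (trans (ℚ.∣p*q∣≡∣p∣*∣q∣ (t * q) r)
           (cong₂ _*_ (ℚ.∣p*q∣≡∣p∣*∣q∣ t q) (ℚ.0≤p⇒∣p∣≡p (0≤1/suc (1 ℕ.+ n))))) ⟩
        ∣ t ∣ * ∣ q ∣ * r + ∣ t ∣ * ∣ q ∣ * r
          ≡⟨ solve 3 (λ t q r → t :* q :* r :+ t :* q :* r := t :* ((q :+ q) :* r)) refl
               ∣ t ∣ ∣ q ∣ r ⟩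
        ∣ t ∣ * ((∣ q ∣ + ∣ q ∣) * r)
          ≤⟨ *-monoˡ (ℚ.0≤∣p∣ t) (*1/suc≤1 (1 ℕ.+ n) (ℚ.≤-trans (ℚ.+-mono-≤ ∣q∣≤1 ∣q∣≤1)
               (fromℕ-mono {2} {2 ℕ.+ n} (s≤s (s≤s z≤n))))) ⟩
        ∣ t ∣ * 1ℚ                        ≡⟨ ℚ.*-identityʳ ∣ t ∣ ⟩
        ∣ t ∣                             ∎
        where
        t = T (1 ℕ.+ n)
        r = 1/suc (1 ℕ.+ n)

      bound : ∀ n → S (2 ℕ.+ n) + (∣ T (2 ℕ.+ n) ∣ + ∣ T (2 ℕ.+ n) ∣) ≤ 1ℚ + q + q * q
      bound zero = ℚ.≤-reflexive (trans
        (cong (λ u → S 2 + (u + u)) (trans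
          (cong ∣_∣ (solve 1 (λ q → con 1ℚ :* q :* con 1ℚ :* q :* con ½ := q :* q :* con ½) refl q))
          (ℚ.0≤p⇒∣p∣≡p (0≤* (0≤p*p q) (ℚ.<⇒≤ 0<½)))))
        (solve 1 (λ q → con 0ℚ :+ con 1ℚ :+ con 1ℚ :* q :* con 1ℚ :+ (q :* q :* con ½ :+ q :* q :* con ½)
           := con 1ℚ :+ q :+ q :* q) refl q))
      bound (suc n) = begin
        S (2 ℕ.+ n) + t + (∣ T (3 ℕ.+ n) ∣ + ∣ T (3 ℕ.+ n) ∣)
          ≤⟨ ℚ.+-mono-≤ (ℚ.+-monoʳ-≤ (S (2 ℕ.+ n)) (p≤∣p∣ t)) (∣T∣-halves (suc n)) ⟩
        S (2 ℕ.+ n) + ∣ t ∣ + ∣ t ∣     ≡⟨ ℚ.+-assoc (S (2 ℕ.+ n)) ∣ t ∣ ∣ t ∣ ⟩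
        S (2 ℕ.+ n) + (∣ t ∣ + ∣ t ∣)   ≤⟨ bound n ⟩
        1ℚ + q + q * q ∎
        where t = T (2 ℕ.+ n)

open import Defs
module Est = Estimates
open Estimates using (Eventually)

-- The order on Cauchy reals

infixr 4 _⊗_

_⊗_ : ∀ {P Q : Pred ℕ 0ℓ} → Eventually P → Eventually Q → Eventually (λ n → P n × Q n)
(M , p) ⊗ (N , q) = M ℕ.⊔ N , λ n ≤n → p n (Est.⊔ˡ M N ≤n) , q n (Est.⊔ʳ M N ≤n)

eventually : ∀ {P Q : Pred ℕ 0ℓ} → (∀ {n} → P n → Q n) → Eventually P → Eventually Q
eventually f (N , p) = N , λ n N≤n → f (p n N≤n)

bounded : ∀ x → ∃[ B ] 0ℚ Rat.< B × Eventually (λ n → Rat.∣ seq x n ∣ Rat.≤ B)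
bounded x = Est.Cauchy⇒bounded (cauchy x)

≤-pointwise : ∀ {x y} → (∀ n → seq x n Rat.≤ seq y n) → x ≤ y
≤-pointwise {x} {y} x≤y = *≤* λ ε 0<ε → 0 , λ n _ →
  subst (Rat._≤ seq y n Rat.+ ε) (ℚ.+-identityʳ (seq x n)) (ℚ.+-mono-≤ (x≤y n) (ℚ.<⇒≤ 0<ε))

≈-pointwise : ∀ {x y} → (∀ n → seq x n ≡ seq y n) → x ≈ y
≈-pointwise x≡y = ≤-pointwise (ℚ.≤-reflexive ∘ x≡y) , ≤-pointwise (ℚ.≤-reflexive ∘ sym ∘ x≡y)

≤-refl : ∀ {x} → x ≤ x
≤-refl = ≤-pointwise λ _ → ℚ.≤-refl

≤-trans : ∀ {x y z} → x ≤ y → y ≤ z → x ≤ z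
≤-trans {x} {y} {z} (*≤* x≤y) (*≤* y≤z) = *≤* λ ε 0<ε → eventually
  (λ {n} (p , q) → ℚ.≤-trans p (ℚ.≤-trans (ℚ.+-monoˡ-≤ (ε Rat.* ½) q) (ℚ.≤-reflexive (trans
    (ℚ.+-assoc (seq z n) (ε Rat.* ½) (ε Rat.* ½)) (cong (seq z n Rat.+_) (Est.halves ε))))))
  (x≤y (ε Rat.* ½) (Est.half 0<ε) ⊗ y≤z (ε Rat.* ½) (Est.half 0<ε))

≈-sym : ∀ {x y} → x ≈ y → y ≈ x
≈-sym (x≤y , y≤x) = y≤x , x≤y

≈-trans : ∀ {x y z} → x ≈ y → y ≈ z → x ≈ z
≈-trans (x≤y , y≤x) (y≤z , z≤y) = ≤-trans x≤y y≤z , ≤-trans z≤y y≤x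

<⇒≤ : ∀ {x y} → x < y → x ≤ y
<⇒≤ {x} {y} (*<* η 0<η x<y) = *≤* λ ε 0<ε → eventually
  (λ {n} p → ℚ.≤-trans (subst (Rat._≤ seq x n Rat.+ η) (ℚ.+-identityʳ (seq x n))
      (ℚ.+-monoʳ-≤ (seq x n) (ℚ.<⇒≤ 0<η)))
    (ℚ.≤-trans p (subst (Rat._≤ seq y n Rat.+ ε) (ℚ.+-identityʳ (seq y n))
      (ℚ.+-monoʳ-≤ (seq y n) (ℚ.<⇒≤ 0<ε)))))
  x<y

≤⇒≯ : ∀ {x y} → x ≤ y → ¬ x > y
≤⇒≯ {x} {y} (*≤* x≤y) (*<* η 0<η y<x) =
  let N , both = y<x ⊗ x≤y (η Rat.* ½) (Est.half 0<η)
      y+η≤x , x≤y+½η = both N ℕ.≤-refl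
      b = seq y N
  in ℚ.<-irrefl refl (ℚ.<-≤-trans (Est.half 0<η) (subst₂ Rat._≤_
    (solve 2 (λ y h → y :+ (h :+ h) :- (y :+ h) := h) refl b (η Rat.* ½))
    (ℚ.+-inverseʳ (b Rat.+ η Rat.* ½))
    (ℚ.+-monoˡ-≤ (Rat.- (b Rat.+ η Rat.* ½))
      (subst (λ h → b Rat.+ h Rat.≤ b Rat.+ η Rat.* ½) (sym (Est.halves η))
        (ℚ.≤-trans y+η≤x x≤y+½η)))))
  where open ℚSolver.+-*-Solver

fromℚ-mono : ∀ {p q} → p Rat.≤ q → fromℚ p ≤ fromℚ q
fromℚ-mono p≤q = ≤-pointwise λ _ → p≤q

fromℚ-pos : ∀ {q} → 0ℚ Rat.< q → 0ℝ < fromℚ q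
fromℚ-pos {q} 0<q = *<* q 0<q (0 , λ _ _ → ℚ.≤-reflexive (ℚ.+-identityˡ q))

fromℚ-below : ∀ {x} → 0ℝ < x → ∃[ q ] 0ℚ Rat.< q × fromℚ q ≤ x
fromℚ-below {x} (*<* q 0<q q≤x) = q , 0<q , *≤* λ ε 0<ε → eventually
  (λ {n} p → subst₂ Rat._≤_ (trans (ℚ.+-identityʳ _) (ℚ.+-identityˡ q)) refl
    (ℚ.+-mono-≤ p (ℚ.<⇒≤ 0<ε))) q≤x

-- Facts that unfold the real operations to sequences

module _ where
  open ℚSolver.+-*-Solver using (solve; _:=_; _:+_; _:*_; _:-_; :-_; con)
  open Est using (half; halves; 0<½)

  opaque
    unfolding _+_ _*_ -_ ∣_∣ exp

    +-mono-≤ : ∀ {x y u v} → x ≤ y → u ≤ v → x + u ≤ y + v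
    +-mono-≤ {x} {y} {u} {v} (*≤* x≤y) (*≤* u≤v) = *≤* λ ε 0<ε → eventually
      (λ {n} (p , q) → ℚ.≤-trans (ℚ.+-mono-≤ p q) (ℚ.≤-reflexive (trans
        (solve 3 (λ y v h → y :+ h :+ (v :+ h) := y :+ v :+ (h :+ h)) refl
          (seq y n) (seq v n) (ε Rat.* ½))
        (cong (seq y n Rat.+ seq v n Rat.+_) (halves ε)))))
      (x≤y (ε Rat.* ½) (half 0<ε) ⊗ u≤v (ε Rat.* ½) (half 0<ε))

    neg-antimono-≤ : ∀ {x y} → x ≤ y → - y ≤ - x
    neg-antimono-≤ {x} {y} (*≤* x≤y) = *≤* λ ε 0<ε → eventually
      (λ {n} p → subst₂ Rat._≤_
        (solve 3 (λ x y e → x :- (x :+ y) := :- y) refl (seq x n) (seq y n) ε)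
        (solve 3 (λ x y e → y :+ e :- (x :+ y) := :- x :+ e) refl (seq x n) (seq y n) ε)
        (ℚ.+-monoˡ-≤ (Rat.- (seq x n Rat.+ seq y n)) p))
      (x≤y ε 0<ε)

    0≤* : ∀ {x y} → 0ℝ ≤ x → 0ℝ ≤ y → 0ℝ ≤ x * y
    0≤* {x} {y} (*≤* 0≤x) (*≤* 0≤y) = *≤* λ ε 0<ε →
      let B , 0<B , ∣x∣≤B = bounded x
          C , 0<C , ∣y∣≤C = bounded y
          η , 0<η , ηC≡½ε = Series.quotient (half 0<ε) 0<C
          ζ , 0<ζ , ζB≡½ε = Series.quotient (half 0<ε) (ℚ.+-mono-< 0<B 0<η)
      in eventually (λ (0≤x+η , 0≤y+ζ , ∣x∣≤B , ∣y∣≤C) →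
          Series.product-lower 0<η 0<ζ ζB≡½ε ηC≡½ε ∣x∣≤B ∣y∣≤C 0≤x+η 0≤y+ζ)
        (0≤x η 0<η ⊗ 0≤y ζ 0<ζ ⊗ ∣x∣≤B ⊗ ∣y∣≤C)

    -- The sign of `z` is unknown, so both halves of `x ≈ y` are needed to make the difference
    -- small. The reverse inequality is the same statement for `y ≈ x`.
    *-monoˡ-≈ : ∀ {x y} z → x ≈ y → x * z ≤ y * z
    *-monoˡ-≈ {x} {y} z (*≤* x≤y , *≤* y≤x) = *≤* λ ε 0<ε →
      let C , 0<C , ∣z∣≤C = bounded z
          η , 0<η , ηC≡ε = Series.quotient 0<ε 0<C
      in eventually (λ (x≤y+η , y≤x+η , ∣z∣≤C) → Series.product-close 0<η ηC≡ε x≤y+η y≤x+η ∣z∣≤C)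
        (x≤y η 0<η ⊗ y≤x η 0<η ⊗ ∣z∣≤C)

    +-assoc : ∀ x y z → (x + y) + z ≈ x + (y + z)
    +-assoc x y z = ≈-pointwise λ n → ℚ.+-assoc (seq x n) (seq y n) (seq z n)

    +-comm : ∀ x y → x + y ≈ y + x
    +-comm x y = ≈-pointwise λ n → ℚ.+-comm (seq x n) (seq y n)

    +-identityˡ : ∀ x → 0ℝ + x ≈ x
    +-identityˡ x = ≈-pointwise λ n → ℚ.+-identityˡ (seq x n)

    +-inverseˡ : ∀ x → - x + x ≈ 0ℝ
    +-inverseˡ x = ≈-pointwise λ n → ℚ.+-inverseˡ (seq x n)

    *-assoc : ∀ x y z → (x * y) * z ≈ x * (y * z)
    *-assoc x y z = ≈-pointwise λ n → ℚ.*-assoc (seq x n) (seq y n) (seq z n)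

    *-comm : ∀ x y → x * y ≈ y * x
    *-comm x y = ≈-pointwise λ n → ℚ.*-comm (seq x n) (seq y n)

    *-identityˡ : ∀ x → 1ℝ * x ≈ x
    *-identityˡ x = ≈-pointwise λ n → ℚ.*-identityˡ (seq x n)

    *-distribʳ-+ : ∀ x y z → (y + z) * x ≈ y * x + z * x
    *-distribʳ-+ x y z = ≈-pointwise λ n → ℚ.*-distribʳ-+ (seq x n) (seq y n) (seq z n)

    fromℚ-+ : ∀ p q → fromℚ (p Rat.+ q) ≈ fromℚ p + fromℚ q
    fromℚ-+ p q = ≈-pointwise λ _ → refl

    fromℚ-* : ∀ p q → fromℚ (p Rat.* q) ≈ fromℚ p * fromℚ q
    fromℚ-* p q = ≈-pointwise λ _ → refl

    fromℚ-neg : ∀ p → fromℚ (Rat.- p) ≈ - fromℚ p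
    fromℚ-neg p = ≈-pointwise λ _ → refl

    -- Removes the error left by couplings that only approach the transportation distance.
    ≤+fromℚ⇒≤ : ∀ {x y} → (∀ ε → 0ℚ Rat.< ε → x ≤ y + fromℚ ε) → x ≤ y
    ≤+fromℚ⇒≤ {x} {y} x≤y+ε = *≤* λ ε 0<ε → lemma ε 0<ε (x≤y+ε (ε Rat.* ½) (half 0<ε))
      where
      lemma : ∀ ε → 0ℚ Rat.< ε → x ≤ y + fromℚ (ε Rat.* ½) →
        Eventually (λ n → seq x n Rat.≤ seq y n Rat.+ ε)
      lemma ε 0<ε (*≤* x≤) = eventually
        (λ {n} p → ℚ.≤-trans p (ℚ.≤-reflexive (trans
          (ℚ.+-assoc (seq y n) (ε Rat.* ½) (ε Rat.* ½)) (cong (seq y n Rat.+_) (halves ε)))))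
        (x≤ (ε Rat.* ½) (half 0<ε))

    x≤∣x∣ : ∀ x → x ≤ ∣ x ∣
    x≤∣x∣ x = ≤-pointwise λ n → Series.p≤∣p∣ (seq x n)

    0≤x*x : ∀ x → 0ℝ ≤ x * x
    0≤x*x x = ≤-pointwise λ n → Series.0≤p*p (seq x n)

    -- At index n all three diagonals are partial sums of the same length n, so the estimate for
    -- rational arguments applies as soon as one bound `D` covers both sequences.
    exp-+ : ∀ x y → exp (x + y) ≈ exp x * exp y
    exp-+ x y = *≤* (λ ε 0<ε → eventually (λ (p , q) → q) (close ε 0<ε))
              , *≤* (λ ε 0<ε → eventually (λ (p , q) → p) (close ε 0<ε))
      where
      close : ∀ ε → 0ℚ Rat.< ε → Eventually (λ n →
        let p = seq (exp x) n Rat.* seq (exp y) n ; q = seq (exp (x + y)) n in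
        p Rat.≤ q Rat.+ ε × q Rat.≤ p Rat.+ ε)
      close ε 0<ε =
        let B , 0<B , N , ∣x∣≤B = bounded x
            C , 0<C , M , ∣y∣≤C = bounded y
            D = B Rat.+ C
            B≤D = subst (Rat._≤ D) (ℚ.+-identityʳ B) (ℚ.+-monoʳ-≤ B (ℚ.<⇒≤ 0<C))
            C≤D = subst (Rat._≤ D) (ℚ.+-identityˡ C) (ℚ.+-monoˡ-≤ C (ℚ.<⇒≤ 0<B))
            -- At a constant sequence the diagonal is the plain series, so its Cauchy modulus
            -- controls the piece from n to n + n that bounds the error.
            K , tail = cauchy (exp (fromℚ (D Rat.+ D))) ε 0<ε
        in eventually (λ {n} (∣x∣≤B , ∣y∣≤C , tail) →
             let p = seq (exp x) n Rat.* seq (exp y) n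
                 q = seq (exp (x + y)) n
                 D₂ = D Rat.+ D
                 le = ℚ.≤-trans
                   (Series.expSum-product (ℚ.≤-trans (ℚ.<⇒≤ 0<B) B≤D)
                     (ℚ.≤-trans ∣x∣≤B B≤D) (ℚ.≤-trans ∣y∣≤C C≤D) n)
                   (ℚ.≤-trans (Series.p≤∣p∣ (Est.expSum D₂ (n ℕ.+ n) Rat.- Est.expSum D₂ n)) tail)
             in Series.∣p-q∣≤ε⇒p≤q+ε le
              , Series.∣p-q∣≤ε⇒p≤q+ε (subst (Rat._≤ ε) (Est.∣∣-swap p q) le))
           ((N , ∣x∣≤B) ⊗ (M , ∣y∣≤C) ⊗ (K , λ n K≤n → tail (n ℕ.+ n) n
             (ℕ.≤-trans K≤n (ℕ.m≤m+n n n)) K≤n))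

    -- Proved entry by entry, like `exp-cancel`: congruence of `exp` is derived from monotonicity,
    -- which itself rests on these two identities.
    exp-halves : ∀ x → exp (x * fromℚ ½ + x * fromℚ ½) ≈ exp x
    exp-halves x = ≈-pointwise λ n → cong (λ q → Est.expSum q n) (halves (seq x n))

    exp-cancel : ∀ x y → exp (x + (y - x)) ≈ exp y
    exp-cancel x y = ≈-pointwise λ n → cong (λ q → Est.expSum q n)
      (solve 2 (λ x y → x :+ (y :- x) := y) refl (seq x n) (seq y n))

    -- A real bound controls the approximations only up to an ε. Starting from -½ and taking ε = ½
    -- keeps them above -1, where the rational estimate holds; `exp≤1+x+x²` uses the same margin on
    -- both sides.
    1+x≤exp : ∀ {x} → fromℚ (Rat.- ½) ≤ x → 1ℝ + x ≤ exp x
    1+x≤exp {x} (*≤* -½≤x) = *≤* λ ε 0<ε → eventually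
      (λ {n} (-½≤x+½ , p) → ℚ.≤-trans
        (p (subst (Rat.- 1ℚ Rat.≤_) (solve 1 (λ x → x :+ con ½ :- con ½ := x) refl (seq x n))
          (ℚ.+-monoˡ-≤ (Rat.- ½) -½≤x+½)))
        (subst (Rat._≤ Est.expSum (seq x n) n Rat.+ ε) (ℚ.+-identityʳ _)
          (ℚ.+-monoʳ-≤ (Est.expSum (seq x n) n) (ℚ.<⇒≤ 0<ε))))
      (-½≤x ½ 0<½ ⊗ large)
      where
      large : Eventually (λ n → Rat.- 1ℚ Rat.≤ seq x n → 1ℚ Rat.+ seq x n Rat.≤ seq (exp x) n)
      large = 2 , λ { (suc (suc n)) (s≤s (s≤s _)) -1≤x → Series.1+q≤expSum -1≤x n }

    exp≤1+x+x² : ∀ {x} → fromℚ (Rat.- ½) ≤ x → x ≤ fromℚ ½ → exp x ≤ 1ℝ + x + x * x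
    exp≤1+x+x² {x} (*≤* -½≤x) (*≤* x≤½) = *≤* λ ε 0<ε → eventually
      (λ {n} (-½≤x+½ , x≤1 , p) → let b = 1ℚ Rat.+ seq x n Rat.+ seq x n Rat.* seq x n in ℚ.≤-trans
        (p (Series.∣∣-bound (subst (Rat.- 1ℚ Rat.≤_)
          (solve 1 (λ x → x :+ con ½ :- con ½ := x) refl (seq x n))
          (ℚ.+-monoˡ-≤ (Rat.- ½) -½≤x+½)) x≤1))
        (subst (Rat._≤ b Rat.+ ε) (ℚ.+-identityʳ b) (ℚ.+-monoʳ-≤ b (ℚ.<⇒≤ 0<ε))))
      (-½≤x ½ 0<½ ⊗ x≤½ ½ 0<½ ⊗ large)
      where
      large : Eventually (λ n → Rat.∣ seq x n ∣ Rat.≤ 1ℚ →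
        seq (exp x) n Rat.≤ 1ℚ Rat.+ seq x n Rat.+ seq x n Rat.* seq x n)
      large = 2 , λ { (suc (suc n)) (s≤s (s≤s _)) ∣x∣≤1 → Series.expSum≤1+q+q² ∣x∣≤1 n }

-- The reals as a commutative ring and a poset, with a solver

ℝ-commutativeRing : CommutativeRing 0ℓ 0ℓ
ℝ-commutativeRing = record { isCommutativeRing = isCommutativeRing }
  where
  +-cong : Congruent₂ _≈_ _+_
  +-cong (p , p′) (q , q′) = +-mono-≤ p q , +-mono-≤ p′ q′

  *-congʳ : ∀ {x y} z → x ≈ y → x * z ≈ y * z
  *-congʳ z x≈y = *-monoˡ-≈ z x≈y , *-monoˡ-≈ z (≈-sym x≈y)

  *-cong : Congruent₂ _≈_ _*_
  *-cong {x} {y} {u} {v} x≈y u≈v =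
    ≈-trans (*-congʳ u x≈y) (≈-trans (*-comm y u) (≈-trans (*-congʳ y u≈v) (*-comm v y)))

  isEquivalence : IsEquivalence _≈_
  isEquivalence = record { refl = ≤-refl , ≤-refl ; sym = ≈-sym ; trans = ≈-trans }

  setoid : Setoid 0ℓ 0ℓ
  setoid = record { isEquivalence = isEquivalence }

  open Consequences setoid using (comm∧idˡ⇒id; comm∧invˡ⇒inv; comm∧distrʳ⇒distr)

  isCommutativeRing : IsCommutativeRing _≈_ _+_ _*_ -_ 0ℝ 1ℝ
  isCommutativeRing = record
    { isRing = record
      { +-isAbelianGroup = record
        { isGroup = record
          { isMonoid = record
            { isSemigroup = record
              { isMagma = record { isEquivalence = isEquivalence ; ∙-cong = +-cong }
              ; assoc = +-assoc
              }
            ; identity = comm∧idˡ⇒id +-comm +-identityˡ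
            }
          ; inverse = comm∧invˡ⇒inv +-comm +-inverseˡ
          ; ⁻¹-cong = λ (p , q) → neg-antimono-≤ q , neg-antimono-≤ p
          }
        ; comm = +-comm
        }
      ; *-cong = *-cong
      ; *-assoc = *-assoc
      ; *-identity = comm∧idˡ⇒id *-comm *-identityˡ
      ; distrib = comm∧distrʳ⇒distr +-cong *-comm *-distribʳ-+
      }
    ; *-comm = *-comm
    }

ℝ-poset : Poset 0ℓ 0ℓ 0ℓ
ℝ-poset = record
  { isPartialOrder = record
    { isPreorder = record
      { isEquivalence = isEquivalence ; reflexive = proj₁ ; trans = ≤-trans }
    ; antisym = _,_
    }
  }
  where open CommutativeRing ℝ-commutativeRing

open CommutativeRing ℝ-commutativeRing
  using (+-cong; *-cong; semiring)
  renaming (refl to ≈-refl; reflexive to ≡⇒≈; -‿cong to neg-cong)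

module ℝ-Solver where
  private
    ring = fromCommutativeRing ℝ-commutativeRing

    -- Rational rather than integer coefficients, so that identities with fractional constants are
    -- settled by computing the constants.
    morphism : ℚ.+-*-rawRing -Raw-AlmostCommutative⟶ ring
    morphism = record
      { ⟦_⟧ = fromℚ ; +-homo = fromℚ-+ ; *-homo = fromℚ-* ; -‿homo = fromℚ-neg
      ; 0-homo = ≈-refl ; 1-homo = ≈-refl }

    coeff≟ : ∀ p q → Maybe (fromℚ p ≈ fromℚ q)
    coeff≟ p q with p ℚ.≟ q
    ... | yes refl = just ≈-refl
    ... | no  _    = nothing

  open Algebra.Solver.Ring ℚ.+-*-rawRing ring morphism coeff≟ public
    using (solve; _:=_; _:+_; _:*_; _:-_; :-_; con)

open ℝ-Solver
open import Relation.Binary.Reasoning.PartialOrder ℝ-poset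

-- Order properties of products and of the exponential

x≤y⇒0≤y-x : ∀ {x y} → x ≤ y → 0ℝ ≤ y - x
x≤y⇒0≤y-x {x} {y} x≤y = begin
  0ℝ     ≈⟨ solve 1 (λ x → con 0ℚ := x :- x) ≈-refl x ⟩
  x - x  ≤⟨ +-mono-≤ x≤y ≤-refl ⟩
  y - x  ∎

0≤y-x⇒x≤y : ∀ {x y} → 0ℝ ≤ y - x → x ≤ y
0≤y-x⇒x≤y {x} {y} 0≤y-x = begin
  x            ≈⟨ solve 1 (λ x → x := con 0ℚ :+ x) ≈-refl x ⟩
  0ℝ + x       ≤⟨ +-mono-≤ 0≤y-x ≤-refl ⟩
  y - x + x    ≈⟨ solve 2 (λ x y → y :- x :+ x := y) ≈-refl x y ⟩
  y            ∎

*-monoˡ-≤ : ∀ {x y z} → 0ℝ ≤ z → x ≤ y → z * x ≤ z * y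
*-monoˡ-≤ {x} {y} {z} 0≤z x≤y = 0≤y-x⇒x≤y (begin
  0ℝ             ≤⟨ 0≤* 0≤z (x≤y⇒0≤y-x x≤y) ⟩
  z * (y - x)    ≈⟨ solve 3 (λ x y z → z :* (y :- x) := z :* y :- z :* x) ≈-refl x y z ⟩
  z * y - z * x  ∎)

*-monoʳ-≤ : ∀ {x y z} → 0ℝ ≤ z → x ≤ y → x * z ≤ y * z
*-monoʳ-≤ {x} {y} {z} 0≤z x≤y = begin
  x * z  ≈⟨ *-comm x z ⟩
  z * x  ≤⟨ *-monoˡ-≤ 0≤z x≤y ⟩
  z * y  ≈⟨ *-comm z y ⟩
  y * z  ∎

archimedean : ∀ {x} → 0ℝ < x → ∀ c → ∃[ k ] fromℚ c ≤ fromℕ k * x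
archimedean {x} 0<x c =
  let q , 0<q , q≤x = fromℚ-below 0<x
      r , 0<r , rq≡1 = Est.1/pos 0<q
      k , cr≤k = Est.archimedean (c Rat.* r)
  in k , (begin
    fromℚ c
      ≤⟨ fromℚ-mono (subst (Rat._≤ Est.fromℕ k Rat.* q)
           (trans (ℚ.*-assoc c r q) (trans (cong (c Rat.*_) rq≡1) (ℚ.*-identityʳ c)))
           (ℚ.*-monoʳ-≤-nonNeg q ⦃ Rat.nonNegative (ℚ.<⇒≤ 0<q) ⦄ cr≤k)) ⟩
    fromℚ (Est.fromℕ k Rat.* q)  ≈⟨ fromℚ-* (Est.fromℕ k) q ⟩
    fromℕ k * fromℚ q            ≤⟨ *-monoˡ-≤ (fromℚ-mono (Est.0≤fromℕ k)) q≤x ⟩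
    fromℕ k * x                  ∎)

-- Partial sums at a negative argument may be negative, so the sign comes from writing exp x as the
-- square of exp (x / 2).
0≤exp : ∀ x → 0ℝ ≤ exp x
0≤exp x = begin
  0ℝ                     ≤⟨ 0≤x*x (exp h) ⟩
  exp h * exp h          ≈⟨ exp-+ h h ⟨
  exp (h + h)            ≈⟨ exp-halves x ⟩
  exp x                  ∎
  where h = x * fromℚ ½

1≤exp : ∀ {x} → 0ℝ ≤ x → 1ℝ ≤ exp x
1≤exp {x} 0≤x = begin
  1ℝ      ≈⟨ solve 0 (con 1ℚ := con 1ℚ :+ con 0ℚ) ≈-refl ⟩
  1ℝ + 0ℝ ≤⟨ +-mono-≤ ≤-refl 0≤x ⟩
  1ℝ + x  ≤⟨ 1+x≤exp (≤-trans (fromℚ-mono (ℚ.neg-antimono-≤ (ℚ.<⇒≤ Est.0<½))) 0≤x) ⟩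
  exp x   ∎

exp-mono : ∀ {x y} → x ≤ y → exp x ≤ exp y
exp-mono {x} {y} x≤y = begin
  exp x                ≈⟨ solve 1 (λ u → u := u :* con 1ℚ) ≈-refl (exp x) ⟩
  exp x * 1ℝ           ≤⟨ *-monoˡ-≤ (0≤exp x) (1≤exp (x≤y⇒0≤y-x x≤y)) ⟩
  exp x * exp (y - x)  ≈⟨ exp-+ x (y - x) ⟨
  exp (x + (y - x))    ≈⟨ exp-cancel x y ⟩
  exp y                ∎

exp-cong : ∀ {x y} → x ≈ y → exp x ≈ exp y
exp-cong (x≤y , y≤x) = exp-mono x≤y , exp-mono y≤x

-- Multiply by exp (- x); only exp x * exp (- x) ≥ 1 is needed.
*exp≤exp⇒≤exp : ∀ {p} x y → 0ℝ ≤ p → p * exp x ≤ exp y → p ≤ exp (y - x)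
*exp≤exp⇒≤exp {p} x y 0≤p p*eˣ≤eʸ = begin
  p                          ≈⟨ solve 1 (λ p → p := p :* con 1ℚ) ≈-refl p ⟩
  p * 1ℝ
    ≤⟨ *-monoˡ-≤ 0≤p (1≤exp (≈-trans (solve 1 (λ x → con 0ℚ := x :- x) ≈-refl x) ≈-refl .proj₁)) ⟩
  p * exp (x - x)            ≈⟨ *-cong ≈-refl (exp-+ x (- x)) ⟩
  p * (exp x * exp (- x))    ≈⟨ solve 3 (λ p a b → p :* (a :* b) := p :* a :* b) ≈-refl _ _ _ ⟩
  p * exp x * exp (- x)      ≤⟨ *-monoʳ-≤ (0≤exp (- x)) p*eˣ≤eʸ ⟩
  exp y * exp (- x)          ≈⟨ exp-+ y (- x) ⟨
  exp (y - x)                ∎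

-- Finite sums, expectations and masses

open Algebra.Properties.Semiring.Sum semiring
  using (sum-cong-≋; sum-replicate-zero; ∑-distrib-+; ∑-comm; *-distribˡ-sum; *-distribʳ-sum)

fromℕ-suc : ∀ k → fromℕ (suc k) ≈ fromℕ k + 1ℝ
fromℕ-suc k = begin-equality
  fromℕ (suc k)                  ≡⟨ cong fromℚ (Est.fromℕ-suc k) ⟩
  fromℚ (Est.fromℕ k Rat.+ 1ℚ)   ≈⟨ fromℚ-+ (Est.fromℕ k) 1ℚ ⟩
  fromℕ k + 1ℝ                   ∎

0≤fromℕ : ∀ k → 0ℝ ≤ fromℕ k
0≤fromℕ k = fromℚ-mono (Est.0≤fromℕ k)

/-*-cancel : ∀ x k .⦃ _ : NonZero k ⦄ → x / k * fromℕ k ≈ x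
/-*-cancel x (suc k) = begin-equality
  x * fromℚ q * fromℕ (suc k)
    ≈⟨ solve 3 (λ x a b → x :* a :* b := x :* (a :* b)) ≈-refl x (fromℚ q) (fromℕ (suc k)) ⟩
  x * (fromℚ q * fromℕ (suc k))          ≈⟨ *-cong ≈-refl (fromℚ-* q (Est.fromℕ (suc k))) ⟨
  x * fromℚ (q Rat.* Est.fromℕ (suc k))  ≡⟨ cong (λ p → x * fromℚ p) (Est.1/suc-inverse k) ⟩
  x * 1ℝ                                ≈⟨ solve 1 (λ x → x :* con 1ℚ := x) ≈-refl x ⟩
  x                                     ∎
  where q = Est.1/suc k

0≤/ : ∀ {x} k .⦃ _ : NonZero k ⦄ → 0ℝ ≤ x → 0ℝ ≤ x / k
0≤/ (suc k) 0≤x = 0≤* 0≤x (fromℚ-mono (Est.0≤1/suc k))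

Σ-mono : ∀ {n} {p q : Fin n → ℝ} → (∀ i → p i ≤ q i) → Σ[ p ] ≤ Σ[ q ]
Σ-mono {zero}  p≤q = ≤-refl
Σ-mono {suc n} p≤q = +-mono-≤ (p≤q zero) (Σ-mono (p≤q ∘ suc))

0≤Σ : ∀ {n} {p : Fin n → ℝ} → (∀ i → 0ℝ ≤ p i) → 0ℝ ≤ Σ[ p ]
0≤Σ {n} 0≤p = ≤-trans (proj₂ (sum-replicate-zero n)) (Σ-mono 0≤p)

module _ {n : ℕ} where

  E-cong : ∀ (p : Fin n → ℝ) {f g} → (∀ v → f v ≈ g v) → E p f ≈ E p g
  E-cong p f≈g = sum-cong-≋ λ v → *-cong (≈-refl {p v}) (f≈g v)

  E-* : ∀ (p : Fin n → ℝ) c f → E p (λ v → c * f v) ≈ c * E p f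
  E-* p c f = begin-equality
    Σ[ (λ v → p v * (c * f v)) ]
      ≈⟨ (sum-cong-≋ λ v → solve 3 (λ p c f → p :* (c :* f) := c :* (p :* f)) ≈-refl (p v) c (f v)) ⟩
    Σ[ (λ v → c * (p v * f v)) ]  ≈⟨ *-distribˡ-sum c (λ v → p v * f v) ⟨
    c * E p f ∎

  module _ {p : Fin n → ℝ} (isDistribution : IsDistribution p) where
    open IsDistribution isDistribution

    E-mono : ∀ {f g} → (∀ v → f v ≤ g v) → E p f ≤ E p g
    E-mono f≤g = Σ-mono λ v → *-monoˡ-≤ (nonNeg v) (f≤g v)

    E-constant : ∀ c → E p (λ _ → c) ≈ c
    E-constant c = begin-equality
      Σ[ (λ v → p v * c) ]  ≈⟨ *-distribʳ-sum c p ⟨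
      Σ[ p ] * c            ≈⟨ *-cong total ≈-refl ⟩
      1ℝ * c                ≈⟨ *-identityˡ c ⟩
      c                     ∎

    -- Pointwise bounds are averaged in this shape, which is why some of them appear later as
    -- `1ℝ * g y + L`.
    E-affine : ∀ a b f → E p (λ v → a * f v + b) ≈ a * E p f + b
    E-affine a b f = begin-equality
      Σ[ (λ v → p v * (a * f v + b)) ]
        ≈⟨ (sum-cong-≋ λ v → solve 3 (λ p u b → p :* (u :+ b) := p :* u :+ p :* b) ≈-refl
             (p v) (a * f v) b) ⟩
      Σ[ (λ v → p v * (a * f v) + p v * b) ]
        ≈⟨ ∑-distrib-+ (λ v → p v * (a * f v)) (λ v → p v * b) ⟩
      E p (λ v → a * f v) + E p (λ _ → b)    ≈⟨ +-cong (E-* p a f) (E-constant b) ⟩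
      a * E p f + b ∎

  -- Markov's inequality, reduced to a comparison at each vertex of `S`. With `h` zero it also shows
  -- that an empty event has no mass.
  mass-*-≤ : ∀ {p h : Fin n → ℝ} {S} c → (∀ v → v ∈ S → p v * c ≤ h v) → (∀ v → 0ℝ ≤ h v) →
    mass p S * c ≤ Σ[ h ]
  mass-*-≤ {p} {h} {S} c pc≤h 0≤h = begin
    mass p S * c  ≈⟨ *-distribʳ-sum c (λ v → if does (v ∈? S) then p v else 0ℝ) ⟩
    Σ[ (λ v → (if does (v ∈? S) then p v else 0ℝ) * c) ]  ≤⟨ Σ-mono term ⟩
    Σ[ h ] ∎
    where
    term : ∀ v → (if does (v ∈? S) then p v else 0ℝ) * c ≤ h v
    term v with v ∈? S
    ... | yes v∈S = pc≤h v v∈S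
    ... | no  _   = begin
      0ℝ * c  ≈⟨ solve 1 (λ c → con 0ℚ :* c := con 0ℚ) ≈-refl c ⟩
      0ℝ      ≤⟨ 0≤h v ⟩
      h v     ∎

  0≤mass : ∀ {p : Fin n → ℝ} → (∀ v → 0ℝ ≤ p v) → ∀ S → 0ℝ ≤ mass p S
  0≤mass {p} 0≤p S = 0≤Σ term
    where
    term : ∀ v → 0ℝ ≤ (if does (v ∈? S) then p v else 0ℝ)
    term v with v ∈? S
    ... | yes _ = 0≤p v
    ... | no  _ = ≤-refl

finite-bound : ∀ {n} (g : Fin n → ℕ) → ∃[ b ] ∀ i → g i ℕ.≤ b
finite-bound {zero}  g = 0 , λ ()
finite-bound {suc n} g with b , g≤b ← finite-bound (g ∘ suc) =
  g zero ℕ.⊔ b , λ { zero → ℕ.m≤m⊔n (g zero) b ; (suc i) → ℕ.≤-trans (g≤b i) (ℕ.m≤n⊔m (g zero) b) }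

-- Lipschitz functions and the transportation distance

module _ {n : ℕ} {G : Graph n} (conn : Connected G) where
  open Graph G

  d : Fin n → Fin n → ℝ
  d x y = fromℕ (dist conn x y)

  dist≤ : ∀ {k x y} → Walk G k x y → dist conn x y ℕ.≤ k
  dist≤ {k} {x} {y} walk = proj₂ (proj₂ (shortest conn x y)) k walk

  -- Only the one-sided estimate is recorded: the other is that for (y , x).
  DistLipschitz : ℝ → (Fin n → ℝ) → Set
  DistLipschitz L g = ∀ x y → g x - g y ≤ L * d x y

  edges⇒DistLipschitz : ∀ {f} → (∀ u v → u ~ v → f u - f v ≤ 1ℝ) → DistLipschitz 1ℝ f
  edges⇒DistLipschitz {f} edge x y = begin
    f x - f y     ≤⟨ along (proj₁ (proj₂ (shortest conn x y))) ⟩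
    d x y         ≈⟨ *-identityˡ (d x y) ⟨
    1ℝ * d x y    ∎
    where
    along : ∀ {k u v} → Walk G k u v → f u - f v ≤ fromℕ k
    along {u = u} [] = proj₁ (solve 1 (λ a → a :- a := con 0ℚ) ≈-refl (f u))
    along {suc k} {u} {w} (_∷_ {v = v} u~v walk) = begin
      f u - f w
        ≈⟨ solve 3 (λ a b c → a :- c := (b :- c) :+ (a :- b)) ≈-refl (f u) (f v) (f w) ⟩
      (f v - f w) + (f u - f v)  ≤⟨ +-mono-≤ (along walk) (edge u v u~v) ⟩
      fromℕ k + 1ℝ               ≈⟨ fromℕ-suc k ⟨
      fromℕ (suc k)              ∎

  module _ {L : ℝ} (0≤L : 0ℝ ≤ L) {g : Fin n → ℝ} (lip : DistLipschitz L g) where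

    near : ∀ {u v} → dist conn u v ℕ.≤ 1 → g u - g v ≤ L
    near {u} {v} d≤1 = begin
      g u - g v   ≤⟨ lip u v ⟩
      L * d u v   ≤⟨ *-monoˡ-≤ 0≤L (fromℚ-mono (Est.fromℕ-mono d≤1)) ⟩
      L * 1ℝ      ≈⟨ solve 1 (λ l → l :* con 1ℚ := l) ≈-refl L ⟩
      L           ∎

    neighbour-upper : ∀ {x y} → _∈N_ G y x → g y - g x ≤ L
    neighbour-upper (inj₁ refl) = near (ℕ.≤-trans (dist≤ []) z≤n)
    neighbour-upper (inj₂ x~y)  = near (dist≤ (sym~ x~y ∷ []))

    neighbour-lower : ∀ {x y} → _∈N_ G y x → g x - g y ≤ L
    neighbour-lower (inj₁ refl) = near (ℕ.≤-trans (dist≤ []) z≤n)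
    neighbour-lower (inj₂ x~y)  = near (dist≤ (x~y ∷ []))

  -- Kantorovich duality, the easy direction
  coupling-bound : ∀ {L} {g p q : Fin n → ℝ} {A} → DistLipschitz L g → IsCoupling p q A →
    E p g ≤ L * cost conn A + E q g
  coupling-bound {L} {g} {p} {q} {A} lip coupling = begin
    Σ[ (λ x → p x * g x) ]
      ≈⟨ (sum-cong-≋ λ x → begin-equality
           p x * g x                    ≈⟨ *-cong (marginalˡ x) ≈-refl ⟨
           Σ[ A x ] * g x               ≈⟨ *-distribʳ-sum (g x) (A x) ⟩
           Σ[ (λ y → A x y * g x) ]     ∎) ⟩
    Σ[ (λ x → Σ[ (λ y → A x y * g x) ]) ]
      ≤⟨ (Σ-mono λ x → Σ-mono λ y → begin
           A x y * g x
             ≈⟨ solve 3 (λ a u v → a :* u := a :* (u :- v) :+ a :* v) ≈-refl (A x y) (g x) (g y) ⟩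
           A x y * (g x - g y) + A x y * g y
             ≤⟨ +-mono-≤ (*-monoˡ-≤ (nonNeg x y) (lip x y)) ≤-refl ⟩
           A x y * (L * d x y) + A x y * g y
             ≈⟨ solve 4 (λ a l e v → a :* (l :* e) :+ v := l :* (a :* e) :+ v) ≈-refl
                  (A x y) L (d x y) (A x y * g y) ⟩
           L * (A x y * d x y) + A x y * g y  ∎) ⟩
    Σ[ (λ x → Σ[ (λ y → L * (A x y * d x y) + A x y * g y) ]) ]
      ≈⟨ (sum-cong-≋ λ x → begin-equality
           Σ[ (λ y → L * (A x y * d x y) + A x y * g y) ]
             ≈⟨ ∑-distrib-+ (λ y → L * (A x y * d x y)) (λ y → A x y * g y) ⟩
           Σ[ (λ y → L * (A x y * d x y)) ] + Σ[ (λ y → A x y * g y) ]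
             ≈⟨ +-cong (*-distribˡ-sum L (λ y → A x y * d x y)) ≈-refl ⟨
           L * Σ[ (λ y → A x y * d x y) ] + Σ[ (λ y → A x y * g y) ]  ∎) ⟩
    Σ[ (λ x → L * Σ[ (λ y → A x y * d x y) ] + Σ[ (λ y → A x y * g y) ]) ]
      ≈⟨ ∑-distrib-+ (λ x → L * Σ[ (λ y → A x y * d x y) ]) (λ x → Σ[ (λ y → A x y * g y) ]) ⟩
    Σ[ (λ x → L * Σ[ (λ y → A x y * d x y) ]) ] + Σ[ (λ x → Σ[ (λ y → A x y * g y) ]) ]
      ≈⟨ +-cong (≈-sym (*-distribˡ-sum L (λ x → Σ[ (λ y → A x y * d x y) ])))
           (∑-comm λ x y → A x y * g y) ⟩
    L * cost conn A + Σ[ (λ y → Σ[ (λ x → A x y * g y) ]) ]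
      ≈⟨ +-cong ≈-refl (sum-cong-≋ λ y → begin-equality
           Σ[ (λ x → A x y * g y) ]     ≈⟨ *-distribʳ-sum (g y) (λ x → A x y) ⟨
           Σ[ (λ x → A x y) ] * g y     ≈⟨ *-cong (marginalʳ y) ≈-refl ⟩
           q y * g y                    ∎) ⟩
    L * cost conn A + E q g ∎
    where open IsCoupling coupling

  0≤cost : ∀ {p q A} → IsCoupling p q A → 0ℝ ≤ cost conn A
  0≤cost coupling = 0≤Σ λ x → 0≤Σ λ y → 0≤* (nonNeg x y) (0≤fromℕ (dist conn x y))
    where open IsCoupling coupling

  -- The transportation distance is given as an infimum, not as the cost of a minimising coupling.
  nearly-optimal : ∀ {p q w} → IsTransportationDistance conn p q w → ∀ ε → 0ℚ Rat.< ε →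
    ∃[ A ] IsCoupling p q A × cost conn A ≤ w + fromℚ ε
  nearly-optimal (_ , approached) ε 0<ε
    with c , (A , coupling , c≈cost) , c<w+ε ← approached (fromℚ ε) (fromℚ-pos 0<ε) =
    A , coupling , ≤-trans (proj₂ c≈cost) (<⇒≤ c<w+ε)

  0≤transportation : ∀ {p q w} → IsTransportationDistance conn p q w → 0ℝ ≤ w
  0≤transportation isW = ≤+fromℚ⇒≤ λ ε 0<ε →
    let A , coupling , cost≤ = nearly-optimal isW ε 0<ε
    in ≤-trans (0≤cost coupling) cost≤

  -- Since `L ≤ 1`, the error `L * ε` is at most ε, so ε need not be divided by an `L` that may be
  -- 0.
  transportation-bound : ∀ {L g p q w} → 0ℝ ≤ L → L ≤ 1ℝ → DistLipschitz L g →
    IsTransportationDistance conn p q w → E p g - E q g ≤ L * w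
  transportation-bound {L} {g} {p} {q} {w} 0≤L L≤1 lip isW = ≤+fromℚ⇒≤ λ ε 0<ε →
    let A , coupling , cost≤ = nearly-optimal isW ε 0<ε in begin
    E p g - E q g                       ≤⟨ +-mono-≤ (coupling-bound lip coupling) ≤-refl ⟩
    L * cost conn A + E q g - E q g
      ≈⟨ solve 2 (λ a b → a :+ b :- b := a) ≈-refl (L * cost conn A) (E q g) ⟩
    L * cost conn A                     ≤⟨ *-monoˡ-≤ 0≤L cost≤ ⟩
    L * (w + fromℚ ε)
      ≈⟨ solve 3 (λ l w e → l :* (w :+ e) := l :* w :+ l :* e) ≈-refl L w (fromℚ ε) ⟩
    L * w + L * fromℚ ε
      ≤⟨ +-mono-≤ ≤-refl (*-monoʳ-≤ (fromℚ-mono (ℚ.<⇒≤ 0<ε)) L≤1) ⟩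
    L * w + 1ℝ * fromℚ ε                ≈⟨ +-cong ≈-refl (*-identityˡ (fromℚ ε)) ⟩
    L * w + fromℚ ε                     ∎

-- One step of the walk acting on functions

module _ {n : ℕ} {G : Graph n} (m : RandomWalk G) where
  open Graph G
  open RandomWalk m

  average : (Fin n → ℝ) → (Fin n → ℝ)
  average g x = E (step x) g

  -- Vertices outside N(x) carry weight 0, so nothing is asked of `g` and `h` there. This confines
  -- the later estimates to neighbours.
  average-mono : ∀ {g h} x → (∀ y → _∈N_ G y x → g y ≤ h y) → average g x ≤ average h x
  average-mono {g} {h} x g≤h = Σ-mono term
    where
    term : ∀ y → step x y * g y ≤ step x y * h y
    term y with (y Fin.≟ x) ⊎-dec (x ~? y)
    ... | yes y∈N = *-monoˡ-≤ (IsDistribution.nonNeg (isDistribution x) y) (g≤h y y∈N)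
    ... | no  y∉N = proj₁ (begin-equality
      step x y * g y  ≈⟨ *-cong (supported x y y∉N) ≈-refl ⟩
      0ℝ * g y        ≈⟨ solve 2 (λ a b → con 0ℚ :* a := con 0ℚ :* b) ≈-refl (g y) (h y) ⟩
      0ℝ * h y        ≈⟨ *-cong (supported x y y∉N) ≈-refl ⟨
      step x y * h y  ∎)

  -- Averaging functions is adjoint to evolving distributions, and evolving fixes `ν`.
  E-average : ∀ {ν} → IsInvariant m ν → ∀ g → E ν (average g) ≈ E ν g
  E-average {ν} invariantν g = begin-equality
    Σ[ (λ x → ν x * Σ[ (λ y → step x y * g y) ]) ]
      ≈⟨ (sum-cong-≋ λ x → *-distribˡ-sum (ν x) (λ y → step x y * g y)) ⟩
    Σ[ (λ x → Σ[ (λ y → ν x * (step x y * g y)) ]) ]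
      ≈⟨ ∑-comm (λ x y → ν x * (step x y * g y)) ⟩
    Σ[ (λ y → Σ[ (λ x → ν x * (step x y * g y)) ]) ]
      ≈⟨ (sum-cong-≋ λ y → sum-cong-≋ λ x →
           solve 3 (λ a b c → a :* (b :* c) := a :* b :* c) ≈-refl (ν x) (step x y) (g y)) ⟩
    Σ[ (λ y → Σ[ (λ x → ν x * step x y * g y) ]) ]
      ≈⟨ (sum-cong-≋ λ y → begin-equality
           Σ[ (λ x → ν x * step x y * g y) ]  ≈⟨ *-distribʳ-sum (g y) (λ x → ν x * step x y) ⟨
           evolve m ν y * g y                 ≈⟨ *-cong (invariant y) ≈-refl ⟩
           ν y * g y                          ∎) ⟩
    E ν g ∎
    where open IsInvariant invariantν using (invariant)

-- Chosen between 9/32, the bound on `l` obtained in `tail-bound`, and ½, the range of the quadratic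
-- estimate for `exp`.
⅓ : ℚ
⅓ = ℤ.+ 1 Rat./ 3

module _ {n : ℕ} {G : Graph n} (conn : Connected G) (m : RandomWalk G) where
  open RandomWalk m

  module _ {L : ℝ} (0≤L : 0ℝ ≤ L) (L≤1 : L ≤ 1ℝ)
           {g : Fin n → ℝ} (lip : DistLipschitz conn L g) where

    -- A step reaches only vertices where `g` differs by at most `L`. This serves twice: it keeps
    -- the exponent in `average-exp` above -½, and it bounds the drift between successive averages.
    average-lower : ∀ x → g x - average m g x ≤ L
    average-lower x = begin
      g x - average m g x
        ≈⟨ +-cong (E-constant (isDistribution x) (g x)) ≈-refl ⟨
      average m (λ _ → g x) x - average m g x
        ≤⟨ +-mono-≤ (average-mono m x lower) ≤-refl ⟩
      average m (λ y → 1ℝ * g y + L) x - average m g x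
        ≈⟨ +-cong (E-affine (isDistribution x) 1ℝ L g) ≈-refl ⟩
      1ℝ * average m g x + L - average m g x
        ≈⟨ solve 2 (λ a l → con 1ℚ :* a :+ l :- a := l) ≈-refl (average m g x) L ⟩
      L ∎
      where
      lower : ∀ y → _∈N_ G y x → g x ≤ 1ℝ * g y + L
      lower y y∈N = begin
        g x                     ≈⟨ solve 2 (λ a b → a := con 1ℚ :* b :+ (a :- b)) ≈-refl (g x) (g y) ⟩
        1ℝ * g y + (g x - g y)  ≤⟨ +-mono-≤ ≤-refl (neighbour-lower conn 0≤L lip y∈N) ⟩
        1ℝ * g y + L            ∎

    -- Expand around g x rather than around the mean: with Z = l (g y - g x) and
    -- |Z| ≤ l L, e^Z ≤ 1 + Z + Z² averages to at most 1 + l (M g x - g x) + l² L,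
    -- where M g x is the average, and 1 + c ≤ e^c turns this back into an exponential.
    average-exp : ∀ {l} → 0ℝ ≤ l → l ≤ fromℚ ⅓ → ∀ x →
      average m (λ y → exp (l * g y)) x ≤ exp (l * l * L) * exp (l * average m g x)
    average-exp {l} 0≤l l≤⅓ x = begin
      average m (λ y → exp (l * g y)) x
        ≤⟨ average-mono m x pointwise ⟩
      average m (λ y → e * l * g y + e * (1ℝ - l * g x + s)) x
        ≈⟨ E-affine (isDistribution x) (e * l) (e * (1ℝ - l * g x + s)) g ⟩
      e * l * μ + e * (1ℝ - l * g x + s)
        ≈⟨ solve 5 (λ e l μ a s → e :* l :* μ :+ e :* (con 1ℚ :- l :* a :+ s)
             := e :* (con 1ℚ :+ (l :* (μ :- a) :+ s))) ≈-refl e l μ (g x) s ⟩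
      e * (1ℝ + (l * (μ - g x) + s))
        ≤⟨ *-monoˡ-≤ (0≤exp (l * g x)) (1+x≤exp small) ⟩
      e * exp (l * (μ - g x) + s)           ≈⟨ exp-+ (l * g x) (l * (μ - g x) + s) ⟨
      exp (l * g x + (l * (μ - g x) + s))
        ≈⟨ exp-cong (solve 4 (λ l a μ s → l :* a :+ (l :* (μ :- a) :+ s) := s :+ l :* μ) ≈-refl
             l (g x) μ s) ⟩
      exp (s + l * μ)                       ≈⟨ exp-+ s (l * μ) ⟩
      exp s * exp (l * μ)                   ∎
      where
      e = exp (l * g x)
      s = l * l * L
      μ = average m g x

      lL≤⅓ : l * L ≤ fromℚ ⅓
      lL≤⅓ = begin
        l * L    ≤⟨ *-monoˡ-≤ 0≤l L≤1 ⟩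
        l * 1ℝ   ≈⟨ solve 1 (λ l → l :* con 1ℚ := l) ≈-refl l ⟩
        l        ≤⟨ l≤⅓ ⟩
        fromℚ ⅓  ∎

      -½≤-lL : fromℚ (Rat.- ½) ≤ - (l * L)
      -½≤-lL = begin
        fromℚ (Rat.- ½)  ≤⟨ fromℚ-mono (from-yes (Rat.- ½ ℚ.≤? Rat.- ⅓)) ⟩
        fromℚ (Rat.- ⅓)  ≈⟨ fromℚ-neg ⅓ ⟩
        - fromℚ ⅓        ≤⟨ neg-antimono-≤ lL≤⅓ ⟩
        - (l * L)        ∎

      scaled-lower : ∀ {a b} → a - b ≤ L → - (l * L) ≤ l * (b - a)
      scaled-lower {a} {b} a-b≤L = begin
        - (l * L)        ≤⟨ neg-antimono-≤ (*-monoˡ-≤ 0≤l a-b≤L) ⟩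
        - (l * (a - b))  ≈⟨ solve 3 (λ l a b → :- (l :* (a :- b)) := l :* (b :- a)) ≈-refl l a b ⟩
        l * (b - a)      ∎

      0≤s : 0ℝ ≤ s
      0≤s = 0≤* (0≤x*x l) 0≤L

      -- The passage from 1 + c back to e^c is available only for c ≥ -½.
      small : fromℚ (Rat.- ½) ≤ l * (μ - g x) + s
      small = begin
        fromℚ (Rat.- ½)    ≤⟨ -½≤-lL ⟩
        - (l * L)          ≈⟨ solve 1 (λ u → u := u :+ con 0ℚ) ≈-refl (- (l * L)) ⟩
        - (l * L) + 0ℝ     ≤⟨ +-mono-≤ (scaled-lower (average-lower x)) 0≤s ⟩
        l * (μ - g x) + s  ∎

      pointwise : ∀ y → _∈N_ G y x →
        exp (l * g y) ≤ e * l * g y + e * (1ℝ - l * g x + s)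
      pointwise y y∈N = begin
        exp (l * g y)
          ≈⟨ exp-cong (solve 3 (λ l a b → l :* b := l :* a :+ l :* (b :- a)) ≈-refl l (g x) (g y)) ⟩
        exp (l * g x + z)          ≈⟨ exp-+ (l * g x) z ⟩
        e * exp z
          ≤⟨ *-monoˡ-≤ (0≤exp (l * g x)) (≤-trans
               (exp≤1+x+x² (≤-trans -½≤-lL lower)
                 (≤-trans upper (≤-trans lL≤⅓ (fromℚ-mono (from-yes (⅓ ℚ.≤? ½))))))
               (+-mono-≤ ≤-refl square)) ⟩
        e * (1ℝ + z + s)
          ≈⟨ solve 5 (λ e l a b s → e :* (con 1ℚ :+ l :* (b :- a) :+ s)
               := e :* l :* b :+ e :* (con 1ℚ :- l :* a :+ s)) ≈-refl e l (g x) (g y) s ⟩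
        e * l * g y + e * (1ℝ - l * g x + s) ∎
        where
        z = l * (g y - g x)

        lower : - (l * L) ≤ z
        lower = scaled-lower (neighbour-lower conn 0≤L lip y∈N)

        upper : z ≤ l * L
        upper = *-monoˡ-≤ 0≤l (neighbour-upper conn 0≤L lip y∈N)

        -- The product of the distances of `z` from the ends of [-lL, lL] is l²L² - z² ≥ 0, and
        -- `L ≤ 1` weakens L² to L.
        square : z * z ≤ s
        square = 0≤y-x⇒x≤y (begin
          0ℝ  ≈⟨ solve 0 (con 0ℚ := con 0ℚ :+ con 0ℚ) ≈-refl ⟩
          0ℝ + 0ℝ
            ≤⟨ +-mono-≤ (0≤* (x≤y⇒0≤y-x lower) (x≤y⇒0≤y-x upper))
                 (0≤* 0≤s (x≤y⇒0≤y-x L≤1)) ⟩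
          (z - - (l * L)) * (l * L - z) + s * (1ℝ - L)
            ≈⟨ solve 3 (λ l L z →
                 (z :- :- (l :* L)) :* (l :* L :- z) :+ l :* l :* L :* (con 1ℚ :- L)
                 := l :* l :* L :- z :* z) ≈-refl l L z ⟩
          s - z * z ∎)

  -- From curvature to contraction

  module _ {κ k : ℝ} {x y : Fin n} (x≢y : x ≢ y) where
    private instance
      dist≢0 : NonZero (dist conn x y)
      dist≢0 = dist-nonZero conn x≢y

    curvature⇒κ≤1 : IsCurvature conn m x y x≢y k → κ ≤ k → κ ≤ 1ℝ
    curvature⇒κ≤1 (w , isW , k≈) κ≤k = begin
      κ                          ≤⟨ κ≤k ⟩
      k                          ≈⟨ k≈ ⟩
      1ℝ - w / dist conn x y
        ≤⟨ +-mono-≤ ≤-refl (neg-antimono-≤ (0≤/ (dist conn x y) (0≤transportation conn isW))) ⟩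
      1ℝ - 0ℝ                    ≈⟨ solve 0 (con 1ℚ :- con 0ℚ := con 1ℚ) ≈-refl ⟩
      1ℝ                         ∎

    curvature⇒transportation : IsCurvature conn m x y x≢y k → κ ≤ k →
      ∃[ w ] IsTransportationDistance conn (step x) (step y) w × w ≤ (1ℝ - κ) * d conn x y
    curvature⇒transportation (w , isW , k≈) κ≤k = w , isW , (begin
      w                       ≈⟨ /-*-cancel w (dist conn x y) ⟨
      ratio * d conn x y      ≤⟨ *-monoʳ-≤ (0≤fromℕ (dist conn x y)) ratio≤ ⟩
      (1ℝ - κ) * d conn x y   ∎)
      where
      ratio = w / dist conn x y
      ratio≤ : ratio ≤ 1ℝ - κ
      ratio≤ = begin
        ratio              ≈⟨ solve 1 (λ u → u := con 1ℚ :- (con 1ℚ :- u)) ≈-refl ratio ⟩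
        1ℝ - (1ℝ - ratio)  ≤⟨ +-mono-≤ ≤-refl (neg-antimono-≤ (≤-trans κ≤k (proj₁ k≈))) ⟩
        1ℝ - κ             ∎

  module _ {κ : ℝ} (curv : CurvatureAtLeast conn m κ) where

    κ≤1 : ∀ {x y} → x ≢ y → κ ≤ 1ℝ
    κ≤1 {x} {y} x≢y =
      let k , isCurvature , κ≤k = curv x y x≢y in curvature⇒κ≤1 x≢y isCurvature κ≤k

    average-contracts : ∀ {L g} → 0ℝ ≤ L → L ≤ 1ℝ → κ ≤ 1ℝ → DistLipschitz conn L g →
      DistLipschitz conn (L * (1ℝ - κ)) (average m g)
    average-contracts {L} {g} 0≤L L≤1 κ≤1 lip x y = contracts (x Fin.≟ y)
      where
      contracts : Dec (x ≡ y) → average m g x - average m g y ≤ L * (1ℝ - κ) * d conn x y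
      -- Curvature speaks only of distinct vertices. At equal ones the right-hand side merely has to
      -- be nonnegative, which uses `κ ≤ 1`.
      contracts (yes refl) = begin
        average m g x - average m g x  ≈⟨ solve 1 (λ a → a :- a := con 0ℚ) ≈-refl (average m g x) ⟩
        0ℝ
          ≤⟨ 0≤* (0≤* 0≤L (x≤y⇒0≤y-x κ≤1)) (0≤fromℕ (dist conn x x)) ⟩
        L * (1ℝ - κ) * d conn x x ∎
      contracts (no x≢y) =
        let k , isCurvature , κ≤k = curv x y x≢y
            w , isW , w≤ = curvature⇒transportation x≢y isCurvature κ≤k in begin
        average m g x - average m g y  ≤⟨ transportation-bound conn 0≤L L≤1 lip isW ⟩
        L * w                          ≤⟨ *-monoˡ-≤ 0≤L w≤ ⟩
        L * ((1ℝ - κ) * d conn x y)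
          ≈⟨ solve 3 (λ a b c → a :* (b :* c) := a :* b :* c) ≈-refl L (1ℝ - κ) (d conn x y) ⟩
        L * (1ℝ - κ) * d conn x y      ∎

-- Iterated averages and Chernoff's bound

-- The accuracy to which iterated averages approximate the mean. At l = t κ / 4 it costs l / 8 ≤ t²
-- κ / 32, by `1 ≤ t`.
1/8 8ℚ : ℚ
1/8 = ℤ.+ 1 Rat./ 8
8ℚ = ℤ.+ 8 Rat./ 1

module _ {n : ℕ} {G : Graph n} (conn : Connected G) (m : RandomWalk G)
         {ν : Fin n → ℝ} (invariantν : IsInvariant m ν)
         {κ : ℝ} (0<κ : 0ℝ < κ) (κ≤1 : κ ≤ 1ℝ) (curv : CurvatureAtLeast conn m κ) where
  open IsInvariant invariantν using () renaming (isDistribution to distributionν)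
  open IsDistribution distributionν using (nonNeg)

  ρ : ℕ → ℝ
  ρ zero    = 1ℝ
  ρ (suc k) = ρ k * (1ℝ - κ)

  Σρ : ℕ → ℝ
  Σρ zero    = 0ℝ
  Σρ (suc k) = Σρ k + ρ k

  0≤κ : 0ℝ ≤ κ
  0≤κ = <⇒≤ 0<κ

  0≤ρ : ∀ k → 0ℝ ≤ ρ k
  0≤ρ zero    = fromℚ-mono (ℚ.<⇒≤ Est.0<1)
  0≤ρ (suc k) = 0≤* (0≤ρ k) (x≤y⇒0≤y-x κ≤1)

  ρ-decreasing : ∀ k → ρ (suc k) ≤ ρ k
  ρ-decreasing k = 0≤y-x⇒x≤y (begin
    0ℝ                   ≤⟨ 0≤* (0≤ρ k) 0≤κ ⟩
    ρ k * κ              ≈⟨ solve 2 (λ r κ → r :* κ := r :- r :* (con 1ℚ :- κ)) ≈-refl (ρ k) κ ⟩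
    ρ k - ρ (suc k)      ∎)

  ρ≤1 : ∀ k → ρ k ≤ 1ℝ
  ρ≤1 zero    = ≤-refl
  ρ≤1 (suc k) = ≤-trans (ρ-decreasing k) (ρ≤1 k)

  κ*Σρ : ∀ k → κ * Σρ k ≈ 1ℝ - ρ k
  κ*Σρ zero    = solve 1 (λ κ → κ :* con 0ℚ := con 1ℚ :- con 1ℚ) ≈-refl κ
  κ*Σρ (suc k) = begin-equality
    κ * (Σρ k + ρ k)     ≈⟨ solve 3 (λ κ s r → κ :* (s :+ r) := κ :* s :+ κ :* r) ≈-refl κ (Σρ k) (ρ k) ⟩
    κ * Σρ k + κ * ρ k   ≈⟨ +-cong (κ*Σρ k) ≈-refl ⟩
    1ℝ - ρ k + κ * ρ k   ≈⟨ solve 2 (λ κ r → con 1ℚ :- r :+ κ :* r := con 1ℚ :- r :* (con 1ℚ :- κ)) ≈-refl κ (ρ k) ⟩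
    1ℝ - ρ (suc k)       ∎

  κ*Σρ≤1 : ∀ k → κ * Σρ k ≤ 1ℝ
  κ*Σρ≤1 k = begin
    κ * Σρ k    ≈⟨ κ*Σρ k ⟩
    1ℝ - ρ k    ≤⟨ +-mono-≤ ≤-refl (neg-antimono-≤ (0≤ρ k)) ⟩
    1ℝ - 0ℝ     ≈⟨ solve 0 (con 1ℚ :- con 0ℚ := con 1ℚ) ≈-refl ⟩
    1ℝ          ∎

  -- Decay without logarithms: in a decreasing sequence the k-th term is at most the average of the
  -- earlier ones, and their sum times κ is at most 1, so `ρ k` is at most 1/(kκ).
  k*ρ≤Σρ : ∀ k → fromℕ k * ρ k ≤ Σρ k
  k*ρ≤Σρ zero    = proj₁ (solve 1 (λ r → con 0ℚ :* r := con 0ℚ) ≈-refl 1ℝ)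
  k*ρ≤Σρ (suc k) = begin
    fromℕ (suc k) * ρ (suc k)    ≤⟨ *-monoˡ-≤ (0≤fromℕ (suc k)) (ρ-decreasing k) ⟩
    fromℕ (suc k) * ρ k          ≈⟨ *-cong (fromℕ-suc k) ≈-refl ⟩
    (fromℕ k + 1ℝ) * ρ k
      ≈⟨ solve 2 (λ a r → (a :+ con 1ℚ) :* r := a :* r :+ r) ≈-refl (fromℕ k) (ρ k) ⟩
    fromℕ k * ρ k + ρ k          ≤⟨ +-mono-≤ (k*ρ≤Σρ k) ≤-refl ⟩
    Σρ k + ρ k                   ∎

  κ-large⇒ρ-small : ∀ {x} k → fromℚ 8ℚ * x ≤ fromℕ k * κ → ρ k * x ≤ fromℚ 1/8
  κ-large⇒ρ-small {x} k 8x≤kκ = begin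
    ρ k * x
      ≈⟨ solve 2 (λ r x → r :* x := con 1/8 :* (r :* (con 8ℚ :* x))) ≈-refl (ρ k) x ⟩
    fromℚ 1/8 * (ρ k * (fromℚ 8ℚ * x))
      ≤⟨ *-monoˡ-≤ 0≤1/8 (*-monoˡ-≤ (0≤ρ k) 8x≤kκ) ⟩
    fromℚ 1/8 * (ρ k * (fromℕ k * κ))
      ≈⟨ solve 4 (λ c r k κ → c :* (r :* (k :* κ)) := c :* (κ :* (k :* r))) ≈-refl
           (fromℚ 1/8) (ρ k) (fromℕ k) κ ⟩
    fromℚ 1/8 * (κ * (fromℕ k * ρ k))
      ≤⟨ *-monoˡ-≤ 0≤1/8 (≤-trans (*-monoˡ-≤ 0≤κ (k*ρ≤Σρ k)) (κ*Σρ≤1 k)) ⟩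
    fromℚ 1/8 * 1ℝ       ≈⟨ solve 1 (λ c → c :* con 1ℚ := c) ≈-refl (fromℚ 1/8) ⟩
    fromℚ 1/8            ∎
    where
    0≤1/8 : 0ℝ ≤ fromℚ 1/8
    0≤1/8 = fromℚ-mono (from-yes (0ℚ ℚ.≤? 1/8))

  ρ-vanishes : ∀ q → ∃[ k ] ρ k * fromℚ q ≤ fromℚ 1/8
  ρ-vanishes q =
    let k , 8q≤kκ = archimedean 0<κ (8ℚ Rat.* q)
    in k , κ-large⇒ρ-small k (≤-trans (proj₂ (fromℚ-* 8ℚ q)) 8q≤kκ)

  module _ {f : Fin n → ℝ} (lip : DistLipschitz conn 1ℝ f) where

    iterate : ℕ → Fin n → ℝ
    iterate zero    = f
    iterate (suc k) = average m (iterate k)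

    iterate-lip : ∀ k → DistLipschitz conn (ρ k) (iterate k)
    iterate-lip zero    = lip
    iterate-lip (suc k) = average-contracts conn m curv (0≤ρ k) (ρ≤1 k) κ≤1 (iterate-lip k)

    E-iterate : ∀ k → E ν (iterate k) ≈ E ν f
    E-iterate zero    = ≈-refl
    E-iterate (suc k) = ≈-trans (E-average m invariantν (iterate k)) (E-iterate k)

    f-iterate≤Σρ : ∀ k v → f v - iterate k v ≤ Σρ k
    f-iterate≤Σρ zero    v = proj₁ (solve 1 (λ a → a :- a := con 0ℚ) ≈-refl (f v))
    f-iterate≤Σρ (suc k) v = begin
      f v - iterate (suc k) v
        ≈⟨ solve 3 (λ a b c → a :- c := (a :- b) :+ (b :- c)) ≈-refl
             (f v) (iterate k v) (iterate (suc k) v) ⟩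
      (f v - iterate k v) + (iterate k v - iterate (suc k) v)
        ≤⟨ +-mono-≤ (f-iterate≤Σρ k v) (average-lower conn m (0≤ρ k) (ρ≤1 k) (iterate-lip k) v) ⟩
      Σρ k + ρ k ∎

    -- With `D` bounding all distances and `ρ k * D` at most 1/8, any two values of `iterate k`
    -- differ by at most 1/8; averaging over the second vertex compares the first with the mean,
    -- which averaging preserves.
    iterate-near-mean : ∃[ k ] ∀ v → iterate k v ≤ E ν f + fromℚ 1/8
    iterate-near-mean =
      let row = λ x → finite-bound (dist conn x)
          D , row≤D = finite-bound (λ x → proj₁ (row x))
          k , ρD≤1/8 = ρ-vanishes (Est.fromℕ D)
      in k , λ v → begin
        iterate k v                     ≈⟨ E-constant distributionν (iterate k v) ⟨
        E ν (λ _ → iterate k v)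
          ≤⟨ (E-mono distributionν λ y → begin
               iterate k v
                 ≈⟨ solve 2 (λ a b → a := con 1ℚ :* b :+ (a :- b)) ≈-refl (iterate k v) (iterate k y) ⟩
               1ℝ * iterate k y + (iterate k v - iterate k y)
                 ≤⟨ +-mono-≤ ≤-refl (≤-trans (iterate-lip k v y) (≤-trans
                      (*-monoˡ-≤ (0≤ρ k) (fromℚ-mono (Est.fromℕ-mono
                        (ℕ.≤-trans (proj₂ (row v) y) (row≤D v)))))
                      ρD≤1/8)) ⟩
               1ℝ * iterate k y + fromℚ 1/8  ∎) ⟩
        E ν (λ y → 1ℝ * iterate k y + fromℚ 1/8)
          ≈⟨ E-affine distributionν 1ℝ (fromℚ 1/8) (iterate k) ⟩
        1ℝ * E ν (iterate k) + fromℚ 1/8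
          ≈⟨ +-cong (≈-trans (*-identityˡ (E ν (iterate k))) (E-iterate k)) ≈-refl ⟩
        E ν f + fromℚ 1/8               ∎

    module _ {l : ℝ} (0≤l : 0ℝ ≤ l) (l≤⅓ : l ≤ fromℚ ⅓) where

      E-exp : (Fin n → ℝ) → ℝ
      E-exp g = E ν (λ v → exp (l * g v))

      E-exp-iterate : ∀ k → E-exp f ≤ exp (l * l * Σρ k) * E-exp (iterate k)
      E-exp-iterate zero = begin
        E-exp f                          ≈⟨ *-identityˡ (E-exp f) ⟨
        1ℝ * E-exp f
          ≤⟨ *-monoʳ-≤ 0≤E-exp (1≤exp (0≤* (0≤x*x l) ≤-refl)) ⟩
        exp (l * l * 0ℝ) * E-exp f       ∎
        where
        0≤E-exp : 0ℝ ≤ E-exp f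
        0≤E-exp = 0≤Σ λ v → 0≤* (nonNeg v) (0≤exp (l * f v))
      E-exp-iterate (suc k) = begin
        E-exp f                                  ≤⟨ E-exp-iterate k ⟩
        -- Invariance inserts an averaging step under `E ν` for free, and `average-exp` then applies
        -- at every vertex.
        a * E-exp g                              ≈⟨ *-cong ≈-refl (E-average m invariantν (λ v → exp (l * g v))) ⟨
        a * E ν (average m (λ v → exp (l * g v)))
          ≤⟨ *-monoˡ-≤ (0≤exp (l * l * Σρ k)) (E-mono distributionν
               (average-exp conn m (0≤ρ k) (ρ≤1 k) (iterate-lip k) 0≤l l≤⅓)) ⟩
        a * E ν (λ v → b * exp (l * g′ v))       ≈⟨ *-cong ≈-refl (E-* ν b (λ v → exp (l * g′ v))) ⟩
        a * (b * E-exp g′)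
          ≈⟨ solve 3 (λ a b c → a :* (b :* c) := a :* b :* c) ≈-refl a b (E-exp g′) ⟩
        a * b * E-exp g′
          ≈⟨ *-cong (exp-+ (l * l * Σρ k) (l * l * ρ k)) ≈-refl ⟨
        exp (l * l * Σρ k + l * l * ρ k) * E-exp g′
          ≈⟨ *-cong (exp-cong (solve 3 (λ l s r → l :* l :* s :+ l :* l :* r := l :* l :* (s :+ r))
               ≈-refl l (Σρ k) (ρ k))) ≈-refl ⟩
        exp (l * l * Σρ (suc k)) * E-exp g′      ∎
        where
        g  = iterate k
        g′ = iterate (suc k)
        a  = exp (l * l * Σρ k)
        b  = exp (l * l * ρ k)

      chernoff : ∀ k → (∀ v → iterate k v ≤ E ν f + fromℚ 1/8) →
        ∀ {t} S → (∀ v → v ∈ S → t ≤ f v - E ν f) →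
        mass ν S ≤ exp (l * l * Σρ k + l * fromℚ 1/8 - l * t)
      chernoff k near-mean {t} S S⊆ = begin
        mass ν S
          ≤⟨ *exp≤exp⇒≤exp (l * (μ + t)) (l * l * Σρ k + l * (μ + fromℚ 1/8)) (0≤mass nonNeg S) (begin
               mass ν S * exp (l * (μ + t))
                 ≤⟨ mass-*-≤ (exp (l * (μ + t)))
                      (λ v v∈S → *-monoˡ-≤ (nonNeg v) (exp-mono (*-monoˡ-≤ 0≤l (μ+t≤f v v∈S))))
                      (λ v → 0≤* (nonNeg v) (0≤exp (l * f v))) ⟩
               E-exp f
                 ≤⟨ E-exp-iterate k ⟩
               exp (l * l * Σρ k) * E-exp (iterate k)
                 -- The averaged function is bounded by the constant μ + 1/8, so its exponential
                 -- moment is at most that of a constant.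
                 ≤⟨ *-monoˡ-≤ (0≤exp (l * l * Σρ k)) (E-mono distributionν λ v →
                      exp-mono (*-monoˡ-≤ 0≤l (near-mean v))) ⟩
               exp (l * l * Σρ k) * E ν (λ _ → exp (l * (μ + fromℚ 1/8)))
                 ≈⟨ *-cong ≈-refl (E-constant distributionν (exp (l * (μ + fromℚ 1/8)))) ⟩
               exp (l * l * Σρ k) * exp (l * (μ + fromℚ 1/8))
                 ≈⟨ exp-+ (l * l * Σρ k) (l * (μ + fromℚ 1/8)) ⟨
               exp (l * l * Σρ k + l * (μ + fromℚ 1/8)) ∎) ⟩
        exp (l * l * Σρ k + l * (μ + fromℚ 1/8) - l * (μ + t))
          ≈⟨ exp-cong (solve 5 (λ l s μ e t → l :* l :* s :+ l :* (μ :+ e) :- l :* (μ :+ t)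
               := l :* l :* s :+ l :* e :- l :* t) ≈-refl l (Σρ k) μ (fromℚ 1/8) t) ⟩
        exp (l * l * Σρ k + l * fromℚ 1/8 - l * t) ∎
        where
        μ = E ν f
        μ+t≤f : ∀ v → v ∈ S → μ + t ≤ f v
        μ+t≤f v v∈S = begin
          μ + t             ≤⟨ +-mono-≤ ≤-refl (S⊆ v v∈S) ⟩
          μ + (f v - μ)     ≈⟨ solve 2 (λ a b → a :+ (b :- a) := b) ≈-refl μ (f v) ⟩
          f v               ∎

    -- Of 9/8, the part 1 pays for passing from `f` to its k-th average, by `κ * Σρ k ≤ 1`, and 1/8
    -- for passing on to the mean, by `κ ≤ 1`.
    deviation-bound : ∀ k → (∀ v → iterate k v ≤ E ν f + fromℚ 1/8) →
      ∀ v → κ * (f v - E ν f) ≤ fromℚ (ℤ.+ 9 Rat./ 8)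
    deviation-bound k near-mean v = begin
      κ * (f v - μ)
        ≈⟨ solve 4 (λ κ a b μ → κ :* (a :- μ) := κ :* ((a :- b) :+ (b :- μ))) ≈-refl
             κ (f v) (iterate k v) μ ⟩
      κ * ((f v - iterate k v) + (iterate k v - μ))
        ≤⟨ *-monoˡ-≤ 0≤κ (+-mono-≤ (f-iterate≤Σρ k v) (+-mono-≤ (near-mean v) ≤-refl)) ⟩
      κ * (Σρ k + (μ + fromℚ 1/8 - μ))
        ≈⟨ solve 3 (λ κ s μ → κ :* (s :+ (μ :+ con 1/8 :- μ)) := κ :* s :+ κ :* con 1/8) ≈-refl
             κ (Σρ k) μ ⟩
      κ * Σρ k + κ * fromℚ 1/8
        ≤⟨ +-mono-≤ (κ*Σρ≤1 k) (*-monoʳ-≤ (fromℚ-mono (from-yes (0ℚ ℚ.≤? 1/8))) κ≤1) ⟩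
      1ℝ + 1ℝ * fromℚ 1/8
        ≈⟨ solve 0 (con 1ℚ :+ con 1ℚ :* con 1/8 := con (ℤ.+ 9 Rat./ 8)) ≈-refl ⟩
      fromℚ (ℤ.+ 9 Rat./ 8) ∎
      where μ = E ν f

    -- Chernoff at l = t κ / 4, which is at most 9/32 by the deviation bound.
    tail-bound : ∀ {t} S → (∀ v → v ∈ S → t ≤ f v - E ν f) → 1ℝ ≤ t → ∀ {v} → v ∈ S →
      mass ν S ≤ exp (- (t * t * κ / 7))
    tail-bound {t} S S⊆ 1≤t {v} v∈S =
      ≤-trans (chernoff 0≤l l≤⅓ k near-mean S S⊆) (exp-mono exponent)
      where
      k = proj₁ iterate-near-mean
      near-mean = proj₂ iterate-near-mean
      ¼ = ℤ.+ 1 Rat./ 4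
      1/32 = ℤ.+ 1 Rat./ 32
      l = t * κ * fromℚ ¼

      0≤t : 0ℝ ≤ t
      0≤t = ≤-trans (fromℚ-mono (ℚ.<⇒≤ Est.0<1)) 1≤t

      0≤tκ : 0ℝ ≤ t * κ
      0≤tκ = 0≤* 0≤t 0≤κ

      0≤¼ : 0ℝ ≤ fromℚ ¼
      0≤¼ = fromℚ-mono (from-yes (0ℚ ℚ.≤? ¼))

      0≤l : 0ℝ ≤ l
      0≤l = 0≤* 0≤tκ 0≤¼

      l≤⅓ : l ≤ fromℚ ⅓
      l≤⅓ = begin
        t * κ * fromℚ ¼                   ≤⟨ *-monoʳ-≤ 0≤¼ (*-monoʳ-≤ 0≤κ (S⊆ v v∈S)) ⟩
        (f v - E ν f) * κ * fromℚ ¼       ≈⟨ *-cong (*-comm (f v - E ν f) κ) ≈-refl ⟩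
        κ * (f v - E ν f) * fromℚ ¼       ≤⟨ *-monoʳ-≤ 0≤¼ (deviation-bound k near-mean v) ⟩
        fromℚ (ℤ.+ 9 Rat./ 8) * fromℚ ¼     ≈⟨ fromℚ-* (ℤ.+ 9 Rat./ 8) ¼ ⟨
        fromℚ (ℤ.+ 9 Rat./ 8 Rat.* ¼)       ≤⟨ fromℚ-mono (from-yes (ℤ.+ 9 Rat./ 8 Rat.* ¼ ℚ.≤? ⅓)) ⟩
        fromℚ ⅓                  ∎

      -- The surplus is t²κ (1/4 - 1/16 - 1/32 - 1/7) + t²κ (1 - κ Σρ) / 16 + t κ (t - 1) / 32.
      exponent : l * l * Σρ k + l * fromℚ 1/8 - l * t ≤ - (t * t * κ / 7)
      exponent = 0≤y-x⇒x≤y (begin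
        0ℝ
          ≈⟨ solve 0 (con 0ℚ := con 0ℚ :+ con 0ℚ :+ con 0ℚ) ≈-refl ⟩
        0ℝ + 0ℝ + 0ℝ
          ≤⟨ +-mono-≤ (+-mono-≤
               (0≤* (0≤* 0≤t 0≤tκ) (fromℚ-mono (from-yes (0ℚ ℚ.≤? ℤ.+ 3 Rat./ 224))))
               (0≤* (0≤* (0≤* 0≤t 0≤tκ) (x≤y⇒0≤y-x (κ*Σρ≤1 k)))
                 (fromℚ-mono (from-yes (0ℚ ℚ.≤? ℤ.+ 1 Rat./ 16)))))
               (0≤* (0≤* 0≤tκ (x≤y⇒0≤y-x 1≤t)) (fromℚ-mono (from-yes (0ℚ ℚ.≤? 1/32)))) ⟩
        t * (t * κ) * fromℚ (ℤ.+ 3 Rat./ 224)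
          + t * (t * κ) * (1ℝ - κ * Σρ k) * fromℚ (ℤ.+ 1 Rat./ 16)
          + t * κ * (t - 1ℝ) * fromℚ 1/32
          ≈⟨ solve 3 (λ t κ s →
               t :* (t :* κ) :* con (ℤ.+ 3 Rat./ 224)
                 :+ t :* (t :* κ) :* (con 1ℚ :- κ :* s) :* con (ℤ.+ 1 Rat./ 16)
                 :+ t :* κ :* (t :- con 1ℚ) :* con 1/32
               := :- (t :* t :* κ :* con (ℤ.+ 1 Rat./ 7))
                 :- (t :* κ :* con ¼ :* (t :* κ :* con ¼) :* s :+ t :* κ :* con ¼ :* con 1/8
                     :- t :* κ :* con ¼ :* t))
               ≈-refl t κ (Σρ k) ⟩
        - (t * t * κ / 7) - (l * l * Σρ k + l * fromℚ 1/8 - l * t) ∎)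

-- Both tails, and the degenerate cases

theorem1 : ∀ {n : ℕ} (G : Graph n) (conn : Connected G)
    (m : RandomWalk G) (ν : Fin n → ℝ) → IsErgodic m ν →
    ∀ (κ : ℝ) → κ > 0ℝ → CurvatureAtLeast conn m κ →
    ∀ (f : Fin n → ℝ) → Lipschitz G 1ℝ f →
    ∀ (t : ℝ) → 1ℝ ≤ t →
    (ν [ (λ v → f v - E ν f > t) ]≤ exp (- (t * t * κ / 7)))
    × (ν [ (λ v → f v - E ν f < - t) ]≤ exp (- (t * t * κ / 7)))
theorem1 {n} G conn m ν ergodic κ 0<κ curv f lip t 1≤t =
    (λ S S⊆ → upper-tail edge S (λ v v∈S → <⇒≤ (S⊆ v v∈S)))
  -- The lower tail of `f` is the upper tail of its negative, which has the same Lipschitz constant.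
  , (λ S S⊆ → upper-tail -edge S (λ v v∈S → negated v (<⇒≤ (S⊆ v v∈S))))
  where
  open Graph G
  invariantν = IsErgodic.isInvariant ergodic
  distributionν = IsInvariant.isDistribution invariantν
  open IsDistribution distributionν using (nonNeg)
  -f = λ v → - f v

  bound : ℝ
  bound = exp (- (t * t * κ / 7))

  edge : ∀ u v → u ~ v → f u - f v ≤ 1ℝ
  edge u v u~v = ≤-trans (x≤∣x∣ (f u - f v)) (lip u v u~v)

  -edge : ∀ u v → u ~ v → -f u - -f v ≤ 1ℝ
  -edge u v u~v = begin
    - f u - - f v  ≈⟨ solve 2 (λ a b → :- a :- :- b := b :- a) ≈-refl (f u) (f v) ⟩
    f v - f u      ≤⟨ edge v u (sym~ u~v) ⟩
    1ℝ             ∎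

  negated : ∀ v → f v - E ν f ≤ - t → t ≤ -f v - E ν -f
  negated v f-μ≤-t = begin
    t                            ≈⟨ solve 1 (λ t → t := :- :- t) ≈-refl t ⟩
    - - t                        ≤⟨ neg-antimono-≤ f-μ≤-t ⟩
    - (f v - E ν f)
      ≈⟨ solve 2 (λ a μ → :- (a :- μ) := :- a :- con (Rat.- 1ℚ) :* μ) ≈-refl (f v) (E ν f) ⟩
    - f v - fromℚ (Rat.- 1ℚ) * E ν f
      ≈⟨ +-cong ≈-refl (neg-cong (≈-trans (E-cong ν λ u →
           solve 1 (λ a → :- a := con (Rat.- 1ℚ) :* a) ≈-refl (f u)) (E-* ν (fromℚ (Rat.- 1ℚ)) f))) ⟨
    - f v - E ν -f               ∎

  module _ {g : Fin n → ℝ} (edge : ∀ u v → u ~ v → g u - g v ≤ 1ℝ)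
           (S : Subset n) (S⊆ : ∀ v → v ∈ S → t ≤ g v - E ν g) where

    empty : ¬ Nonempty S → mass ν S ≤ bound
    empty S≡∅ = begin
      mass ν S        ≈⟨ solve 1 (λ a → a := a :* con 1ℚ) ≈-refl (mass ν S) ⟩
      mass ν S * 1ℝ
        ≤⟨ mass-*-≤ {h = λ _ → 0ℝ} 1ℝ (λ v v∈S → contradiction (v , v∈S) S≡∅) (λ _ → ≤-refl) ⟩
      Σ[ (λ (_ : Fin n) → 0ℝ) ]  ≈⟨ sum-replicate-zero n ⟩
      0ℝ              ≤⟨ 0≤exp (- (t * t * κ / 7)) ⟩
      bound           ∎

    -- On a single vertex curvature says nothing about κ, but there `g` equals its mean, which is
    -- incompatible with a deviation of at least `t ≥ 1`.
    constant : ∀ v → (∀ u → u ≡ v) → g v - E ν g ≤ 0ℝ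
    constant v all≡v = begin
      g v - E ν g
        ≈⟨ +-cong ≈-refl (neg-cong (E-cong ν λ u → ≡⇒≈ (cong g (all≡v u)))) ⟩
      g v - E ν (λ _ → g v)   ≈⟨ +-cong ≈-refl (neg-cong (E-constant distributionν (g v))) ⟩
      g v - g v               ≈⟨ solve 1 (λ a → a :- a := con 0ℚ) ≈-refl (g v) ⟩
      0ℝ                      ∎

    nonempty : ∀ {v} → v ∈ S → Dec (∃[ u ] u ≢ v) → mass ν S ≤ bound
    nonempty v∈S (yes (u , u≢v)) =
      tail-bound conn m invariantν 0<κ (κ≤1 conn m curv u≢v) curv
        (edges⇒DistLipschitz conn edge) S S⊆ 1≤t v∈S
    nonempty {v} v∈S (no all≡v) = contradiction (fromℚ-pos Est.0<1)
      (≤⇒≯ (≤-trans 1≤t (≤-trans (S⊆ v v∈S)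
        (constant v (λ u → decidable-stable (u Fin.≟ v) (λ u≢v → all≡v (u , u≢v)))))))

    upper-tail : mass ν S ≤ bound
    upper-tail = split (nonempty? S)
      where
      split : Dec (Nonempty S) → mass ν S ≤ bound
      split (yes (v , v∈S)) = nonempty v∈S (Fin.any? λ u → ¬? (u Fin.≟ v))
      split (no  S≡∅)       = empty S≡∅
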